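{- Let $p$ be an odd prime, $s\ge2$, $m\ge1$, $R$ the Galois ring of characteristic $p^{s}$ and cardinality $p^{sm}$, and $\delta\in\{0,1,2\}$. (i) For $\nu=1$, every vertex of $\Gamma^{2+\delta}$ other than $[e_1]$ lies in the $G_{[e_1]}$-orbit of one of the following vertices: $[e_2]$ if $\delta=0$; $[e_2]$ or $[1,-\tfrac12\Delta p^{2r},p^{r}]$ if $\delta=1$; $[e_2]$, $[1,-\tfrac12p^{2r},p^{r},0]$, $[1,\tfrac12zp^{2r},0,p^{r}]$ or $[1,-\tfrac12(b^{2}-z)p^{2r},bp^{r},p^{r}]$ if $\delta=2$, where $b\in R^{*}$ and $0<r<s$. (ii) For $\nu\ge2$, every vertex of $\Gamma^{2\nu+\delta}$ other than $[e_1]$ lies in the $G_{[e_1]}$-orbit of one of $[e_{\nu+1}]$, $[e_2]$, $[e_2+p^{r}e_{\nu+1}]$, $[e_1+p^{r}e_2]$, $[e_1+p^{r}e_2-ap^{r+t}e_{\nu+1}+ap^{t}e_{\nu+2}]$, where $1\le r\le t\le s-1$ and $a\in\{1,z\}$.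
   Context: $R$ is a finite local ring with maximal ideal $pR$ and residue field of order $p^{m}$; $R^{*}$ is its unit group and $z$ a fixed non-square element of $R^{*}$. Vectors of length $2\nu+\delta$ over $R$ having some unit coordinate are considered up to multiplication by units; $[a_1,\dots,a_{2\nu+\delta}]$ denotes the class, and $e_i$ is the $i$-th standard basis vector. Let $S=\begin{pmatrix}0&I^{(\nu)}&0\\ I^{(\nu)}&0&0\\0&0&\Delta\end{pmatrix}$ with $\Delta$ absent if $\delta=0$, $\Delta=(1)$ or $(z)$ (one fixed choice, also used as the scalar $1$ or $z$) if $\delta=1$, $\Delta=\mathrm{diag}(1,-z)$ if $\delta=2$. The orthogonal graph $\Gamma^{2\nu+\delta}$ has vertices the classes $[\alpha]$ with $\alpha S\alpha^{t}=0$, and $[\alpha]\sim[\beta]$ iff $\alpha S\beta^{t}\in R^{*}$. $\mathrm{O}_{2\nu+\delta}(R)=\{T: TST^{t}=S\}$ acts on vertices by $[\alpha]\mapsto[\alpha T]$, and $G_{[e_1]}$ is the stabilizer of $[e_1]$. (Distinct listed representatives may lie in the same orbit.) The paper's standing assumption is $s\ge2$. -}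

module Defs where

open import Level using (Level; _⊔_)
open import Algebra.Bundles using (CommutativeRing)
open import Data.Nat as ℕ using (ℕ; zero; suc; _≤_; _<_; _∸_; _^_)
import Data.Nat.Properties as ℕP
open import Data.Fin using (Fin; toℕ)
open import Data.Vec using (Vec; []; _∷_; lookup)
open import Data.Bool using (Bool; true; false; if_then_else_; _∧_)
open import Data.Product using (Σ; ∃; _×_; _,_)
open import Data.Sum using (_⊎_)
open import Relation.Nullary using (¬_; does)
open import Relation.Binary.PropositionalEquality using (_≡_)

module Orth {c ℓ : Level} (R : CommutativeRing c ℓ) where
  open CommutativeRing R

  nat : ℕ → Carrier
  nat zero = 0#
  nat (suc n) = 1# + nat n

  IsUnit : Carrier → Set (c ⊔ ℓ)
  IsUnit x = ∃ λ y → x * y ≈ 1#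

  HasCard : ℕ → Set (c ⊔ ℓ)
  HasCard N = Σ (Fin N → Carrier) λ f →
                ((i j : Fin N) → f i ≈ f j → i ≡ j) × ((x : Carrier) → ∃ λ i → f i ≈ x)

  HasChar : ℕ → Set ℓ
  HasChar n = (nat n ≈ 0#) × ((k : ℕ) → 0 < k → k < n → ¬ (nat k ≈ 0#))

  IsGaloisRing : ℕ → ℕ → ℕ → Set (c ⊔ ℓ)
  IsGaloisRing p s m =
    HasChar (p ^ s) × HasCard (p ^ (s ℕ.* m)) ×
    ((x : Carrier) → (¬ IsUnit x → ∃ λ y → x ≈ nat p * y) × ((∃ λ y → x ≈ nat p * y) → ¬ IsUnit x))

  IsNonSquareUnit : Carrier → Set (c ⊔ ℓ)
  IsNonSquareUnit z = IsUnit z × ((y : Carrier) → ¬ (y * y ≈ z))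

  pw : ℕ → ℕ → Carrier
  pw p r = nat (p ^ r)

  Vector : ℕ → Set c
  Vector n = Fin n → Carrier

  Matrix : ℕ → Set c
  Matrix n = Fin n → Fin n → Carrier

  sumF : (n : ℕ) → (Fin n → Carrier) → Carrier
  sumF zero f = 0#
  sumF (suc n) f = f Fin.zero + sumF n (λ i → f (Fin.suc i))

  -- standard basis vector e_i (1-indexed, as in the paper)
  e : {n : ℕ} → ℕ → Vector n
  e i j = if does (suc (toℕ j) ℕ.≟ i) then 1# else 0#

  -- entries of Δ (0-indexed within the Δ block); d is the fixed choice 1 or z when δ = 1
  Δe : ℕ → Carrier → Carrier → ℕ → Carrier
  Δe 1 d z 0 = d
  Δe 2 d z 0 = 1#
  Δe 2 d z 1 = - z
  Δe _ d z _ = 0#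

  -- the matrix S = [[0, I_ν, 0], [I_ν, 0, 0], [0, 0, Δ]] of size 2ν+δ
  Smat : (ν δ : ℕ) → Carrier → Carrier → Matrix (2 ℕ.* ν ℕ.+ δ)
  Smat ν δ d z i j =
    if does (a ℕ.<? ν) ∧ does (b ℕ.≟ a ℕ.+ ν) then 1#
    else if does (ν ℕ.≤? a) ∧ does (a ℕ.<? 2 ℕ.* ν) ∧ does (a ℕ.≟ b ℕ.+ ν) then 1#
    else if does (2 ℕ.* ν ℕ.≤? a) ∧ does (a ℕ.≟ b) then Δe δ d z (a ∸ 2 ℕ.* ν)
    else 0#
    where
    a = toℕ i
    b = toℕ j

  form : {n : ℕ} → Matrix n → Vector n → Vector n → Carrier
  form {n} M α β = sumF n (λ i → sumF n (λ j → α i * M i j * β j))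

  _·M_ : {n : ℕ} → Vector n → Matrix n → Vector n
  _·M_ {n} α T j = sumF n (λ i → α i * T i j)

  _⊗_ : {n : ℕ} → Matrix n → Matrix n → Matrix n
  _⊗_ {n} A B i j = sumF n (λ k → A i k * B k j)

  tr : {n : ℕ} → Matrix n → Matrix n
  tr A i j = A j i

  -- equality of classes [α] = [β] : α = u β for a unit u
  _∼_ : {n : ℕ} → Vector n → Vector n → Set (c ⊔ ℓ)
  _∼_ {n} α β = ∃ λ u → IsUnit u × ((i : Fin n) → α i ≈ u * β i)

  _≋_ : {n : ℕ} → Vector n → Vector n → Set ℓ
  _≋_ {n} α β = (i : Fin n) → α i ≈ β i

  module Graph (ν δ : ℕ) (d z : Carrier) where
    n : ℕ
    n = 2 ℕ.* ν ℕ.+ δ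

    S : Matrix n
    S = Smat ν δ d z

    IsVertex : Vector n → Set (c ⊔ ℓ)
    IsVertex α = (∃ λ i → IsUnit (α i)) × (form S α α ≈ 0#)

    IsOrthogonal : Matrix n → Set ℓ
    IsOrthogonal T = (i j : Fin n) → ((T ⊗ S) ⊗ tr T) i j ≈ S i j

    InStab : Matrix n → Set (c ⊔ ℓ)
    InStab T = IsOrthogonal T × ((e 1 ·M T) ∼ e 1)

    OrbitClaim : (Vector n → Set (c ⊔ ℓ)) → Set (c ⊔ ℓ)
    OrbitClaim Rep = (α : Vector n) → IsVertex α → ¬ (α ∼ e 1) →
      ∃ λ β → Rep β × ∃ λ T → InStab T × (α ∼ (β ·M T))

  -- the lists of representatives in Theorem 2.5; h denotes 1/2 (h + h = 1)
  module Reps (p s : ℕ) (h z d : Carrier) where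
    v3 : Carrier → Carrier → Carrier → Vector 3
    v3 x y w = lookup (x ∷ y ∷ w ∷ [])

    v4 : Carrier → Carrier → Carrier → Carrier → Vector 4
    v4 x y w t = lookup (x ∷ y ∷ w ∷ t ∷ [])

    Rep10 : Vector 2 → Set (c ⊔ ℓ)
    Rep10 β = Level.Lift c (β ≋ e 2)

    Rep11 : Vector 3 → Set (c ⊔ ℓ)
    Rep11 β = Level.Lift c (β ≋ e 2)
      ⊎ ∃ λ r → 0 < r × r < s × β ≋ v3 1# (- (h * (d * pw p (2 ℕ.* r)))) (pw p r)

    Rep12 : Vector 4 → Set (c ⊔ ℓ)
    Rep12 β = Level.Lift c (β ≋ e 2)
      ⊎ (∃ λ r → 0 < r × r < s × β ≋ v4 1# (- (h * pw p (2 ℕ.* r))) (pw p r) 0#)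
      ⊎ (∃ λ r → 0 < r × r < s × β ≋ v4 1# (h * (z * pw p (2 ℕ.* r))) 0# (pw p r))
      ⊎ (∃ λ r → 0 < r × r < s × Σ Carrier λ b → IsUnit b ×
           β ≋ v4 1# (- (h * ((b * b - z) * pw p (2 ℕ.* r)))) (b * pw p r) (pw p r))

    Rep2 : (ν δ : ℕ) → Vector (2 ℕ.* ν ℕ.+ δ) → Set (c ⊔ ℓ)
    Rep2 ν δ β = Level.Lift c (β ≋ e (suc ν))
      ⊎ Level.Lift c (β ≋ e 2)
      ⊎ (∃ λ r → 1 ≤ r × r ≤ s ∸ 1 × β ≋ (λ i → e 2 i + pw p r * e (suc ν) i))
      ⊎ (∃ λ r → 1 ≤ r × r ≤ s ∸ 1 × β ≋ (λ i → e 1 i + pw p r * e 2 i))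
      ⊎ (∃ λ r → ∃ λ t → 1 ≤ r × r ≤ t × t ≤ s ∸ 1 × Σ Carrier λ a → (a ≈ 1# ⊎ a ≈ z) ×
           β ≋ (λ i → e 1 i + pw p r * e 2 i - a * pw p (r ℕ.+ t) * e (suc ν) i
                        + a * pw p t * e (2 ℕ.+ ν) i))

{-# OPTIONS --safe #-}
-- Write B for the bilinear form and α = a e₁ + b f₁ + w with f₁ = e_{ν+1} and w orthogonal to
-- e₁ and f₁. If b is a unit, an Eichler transformation fixing e₁ takes f₁ to a multiple of α.
-- Otherwise isometries of the complement of ⟨e₁, f₁⟩ are used to simplify w.
--
-- For ν ≥ 2 every w with a unit coordinate can be moved to e₂ + q f₂, where f₂ = e_{ν+2}. If w
-- itself has a unit coordinate, an Eichler transformation then clears a, which leaves e₂ + b f₁.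
-- If not, a is a unit, w = pʳ w′ with w′ movable to e₂ + q f₂, and B(α,α) = 0 determines b;
-- rescaling the two hyperbolic planes changes q by squares of units, and every unit is x² or z x².
--
-- For ν = 1 the form on w is anisotropic modulo p, so again a is a unit and w = pʳ w′. For δ = 2,
-- if one coordinate of w′ = (c , f) is not a unit, then c² − z f² is a square, respectively −z times
-- a square, and a reflection moves w′ into a coordinate axis.
--
-- Both facts on squares follow from finiteness: an injective self-map of R is surjective.
module Submission where

open import Defs
open import Level using (Level; _⊔_)
open import Algebra.Bundles using (CommutativeRing; RawRing)
open import Data.Bool using (Bool; true; false; if_then_else_; _∧_)
open import Data.Empty using (⊥-elim)
open import Data.Fin using (Fin; toℕ; fromℕ<; punchOut)
open import Data.Fin.Patterns using (0F; 1F; 2F; 3F)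
import Data.Fin.Properties as FinP
open import Data.Maybe using (Maybe; just; nothing)
open import Data.Nat as ℕ using (ℕ; zero; suc; _≤_; _<_; _^_; _%_)
import Data.Nat.Properties as ℕP
open import Data.Nat.Primality using (Prime; prime⇒nonTrivial)
open import Data.Product using (Σ; ∃; _×_; _,_; proj₁; proj₂)
open import Data.Sum using (_⊎_; inj₁; inj₂; [_,_]′)
open import Function.Definitions using (Injective)
open import Relation.Binary.Definitions using (tri<; tri≈; tri>)
open import Relation.Binary.PropositionalEquality as ≡ using (_≡_)
open import Relation.Nullary using (¬_; Dec; yes; no; does)
open import Relation.Nullary.Decidable using (map′; dec-true; dec-false)

-- For ν ≥ 2 the size 2ν + δ stays a variable, so `S` is consulted only for its symmetry and for
-- which coordinate each basis vector reads off; the rest is phrased through `B` and hyperbolic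
-- pairs. All isometries in use alter a vector only by multiples of two fixed vectors, so one family
-- `Φ` covers them and is verified once. A claim asks for T carrying the representative to α, while
-- simplification runs from α to the representative; each move therefore comes with an explicit
-- inverse. No residue field is built: "modulo p" means unit versus nonunit, and congruences are
-- lifted to equalities by taking a square root of 1 + x with x a nonunit. Zero divisors are the
-- obstacle. The vector pʳ v determines v only up to the annihilator of pʳ, so v need not inherit
-- orthogonality from pʳ v; and pʳ q may vanish although q does not. The latter is why e₁ + pʳ e₂ is
-- listed beside the family with r ≤ t, where t = r + k for q = pᵏ u.

-- Polynomial identities with integer coefficients in a commutative ring.

module IntegerSolver {c ℓ} (R : CommutativeRing c ℓ) where
  open CommutativeRing R hiding (zero)
  open import Algebra.Properties.Ring ring using (x[y-z]≈xy-xz; [y-z]x≈yx-zx)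
  open import Algebra.Properties.AbelianGroup +-abelianGroup using (⁻¹-∙-comm; ⁻¹-anti-homo‿-)
  open import Algebra.Properties.CommutativeSemigroup +-commutativeSemigroup using (interchange)
  open import Algebra.Properties.Semiring.Mult.TCOptimised semiring
    using (1+×; ×-homo-+; ×1-homo-*) renaming (_×_ to _×′_)
  open import Algebra.Solver.Ring.AlmostCommutativeRing
  open import Relation.Binary.Reasoning.Setoid setoid

  -- The pair (a , b) stands for the integer a − b; reduced pairs make normal forms unique.
  cancel : ℕ → ℕ → ℕ × ℕ
  cancel zero b = zero , b
  cancel (suc a) zero = suc a , zero
  cancel (suc a) (suc b) = cancel a b

  coefficients : RawRing _ _
  coefficients = record
    { Carrier = ℕ × ℕ
    ; _≈_ = _≡_
    ; _+_ = λ (a , b) (a′ , b′) → cancel (a ℕ.+ a′) (b ℕ.+ b′)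
    ; _*_ = λ (a , b) (a′ , b′) → cancel (a ℕ.* a′ ℕ.+ b ℕ.* b′) (a ℕ.* b′ ℕ.+ b ℕ.* a′)
    ; -_ = λ (a , b) → b , a
    ; 0# = 0 , 0
    ; 1# = 1 , 0
    }

  private
    ι : ℕ → Carrier
    ι k = k ×′ 1#

  -- The case split makes (0 , 0) and (1 , 0) evaluate to 0# and 1# on the nose.
  eval : ℕ × ℕ → Carrier
  eval (a , zero) = ι a
  eval (a , suc b) = ι a - ι (suc b)

  eval-difference : ∀ a b → eval (a , b) ≈ ι a - ι b
  eval-difference a zero = begin
    ι a       ≈⟨ +-identityʳ _ ⟨
    ι a + 0#  ≈⟨ +-congˡ (trans (sym (-‿inverseʳ 0#)) (+-identityˡ _)) ⟩
    ι a - 0#  ∎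
  eval-difference a (suc b) = refl

  difference-+ : ∀ a b a′ b′ → (a + a′) - (b + b′) ≈ (a - b) + (a′ - b′)
  difference-+ a b a′ b′ = begin
    (a + a′) - (b + b′)        ≈⟨ +-congˡ (⁻¹-∙-comm b b′) ⟨
    (a + a′) + (- b + - b′)    ≈⟨ interchange a a′ (- b) (- b′) ⟩
    (a - b) + (a′ - b′)        ∎

  difference-* : ∀ a b a′ b′ → (a * a′ + b * b′) - (a * b′ + b * a′) ≈ (a - b) * (a′ - b′)
  difference-* a b a′ b′ = begin
    (a * a′ + b * b′) - (a * b′ + b * a′)    ≈⟨ difference-+ _ _ _ _ ⟩
    (a * a′ - a * b′) + (b * b′ - b * a′)    ≈⟨ +-congˡ (⁻¹-anti-homo‿- (b * a′) (b * b′)) ⟨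
    (a * a′ - a * b′) - (b * a′ - b * b′)    ≈⟨ +-cong (x[y-z]≈xy-xz a a′ b′) (-‿cong (x[y-z]≈xy-xz b a′ b′))
        ⟨
    a * (a′ - b′) - b * (a′ - b′)            ≈⟨ [y-z]x≈yx-zx (a′ - b′) a b ⟨
    (a - b) * (a′ - b′)                      ∎

  eval-cancel : ∀ a b → eval (cancel a b) ≈ ι a - ι b
  eval-cancel zero b = eval-difference zero b
  eval-cancel (suc a) zero = eval-difference (suc a) zero
  eval-cancel (suc a) (suc b) = begin
    eval (cancel a b)          ≈⟨ eval-cancel a b ⟩
    ι a - ι b                  ≈⟨ +-identityˡ _ ⟨
    0# + (ι a - ι b)           ≈⟨ +-congʳ (-‿inverseʳ 1#) ⟨
    (1# - 1#) + (ι a - ι b)    ≈⟨ difference-+ _ _ _ _ ⟨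
    (1# + ι a) - (1# + ι b)    ≈⟨ +-cong (1+× a 1#) (-‿cong (1+× b 1#)) ⟨
    ι (suc a) - ι (suc b)      ∎

  ι-homo-+* : ∀ a b a′ b′ → ι (a ℕ.* a′ ℕ.+ b ℕ.* b′) ≈ ι a * ι a′ + ι b * ι b′
  ι-homo-+* a b a′ b′ = trans (×-homo-+ 1# (a ℕ.* a′) (b ℕ.* b′)) (+-cong (×1-homo-* a a′) (×1-homo-* b b′))

  morphism : coefficients -Raw-AlmostCommutative⟶ fromCommutativeRing R
  morphism = record
    { ⟦_⟧ = eval
    ; +-homo = λ (a , b) (a′ , b′) → begin
        eval (cancel (a ℕ.+ a′) (b ℕ.+ b′))  ≈⟨ eval-cancel (a ℕ.+ a′) (b ℕ.+ b′) ⟩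
        ι (a ℕ.+ a′) - ι (b ℕ.+ b′)     ≈⟨ +-cong (×-homo-+ 1# a a′) (-‿cong (×-homo-+ 1# b b′)) ⟩
        (ι a + ι a′) - (ι b + ι b′)     ≈⟨ difference-+ _ _ _ _ ⟩
        (ι a - ι b) + (ι a′ - ι b′)     ≈⟨ +-cong (eval-difference a b) (eval-difference a′ b′) ⟨
        eval (a , b) + eval (a′ , b′)   ∎
    ; *-homo = λ (a , b) (a′ , b′) → begin
        eval (cancel (a ℕ.* a′ ℕ.+ b ℕ.* b′) (a ℕ.* b′ ℕ.+ b ℕ.* a′))
          ≈⟨ eval-cancel (a ℕ.* a′ ℕ.+ b ℕ.* b′) (a ℕ.* b′ ℕ.+ b ℕ.* a′) ⟩
        ι (a ℕ.* a′ ℕ.+ b ℕ.* b′) - ι (a ℕ.* b′ ℕ.+ b ℕ.* a′)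
          ≈⟨ +-cong (ι-homo-+* a b a′ b′) (-‿cong (ι-homo-+* a b b′ a′)) ⟩
        (ι a * ι a′ + ι b * ι b′) - (ι a * ι b′ + ι b * ι a′)
          ≈⟨ difference-* _ _ _ _ ⟩
        (ι a - ι b) * (ι a′ - ι b′)
          ≈⟨ *-cong (eval-difference a b) (eval-difference a′ b′) ⟨
        eval (a , b) * eval (a′ , b′)   ∎
    ; -‿homo = λ (a , b) → begin
        eval (b , a)     ≈⟨ eval-difference b a ⟩
        ι b - ι a        ≈⟨ ⁻¹-anti-homo‿- (ι a) (ι b) ⟨
        - (ι a - ι b)    ≈⟨ -‿cong (eval-difference a b) ⟨
        - eval (a , b)   ∎
    ; 0-homo = refl
    ; 1-homo = refl
    }

  -- Cross sums compare the two integers. Equality of integers suffices for equality in R but is not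
  -- necessary, as R may have positive characteristic; hence `Maybe`.
  eval-≟ : (x y : ℕ × ℕ) → Maybe (eval x ≈ eval y)
  eval-≟ (a , b) (a′ , b′) with a ℕ.+ b′ ℕ.≟ a′ ℕ.+ b
  ... | no _ = nothing
  ... | yes eq = just (begin
    eval (a , b)                  ≈⟨ eval-difference a b ⟩
    ι a - ι b                     ≈⟨ +-identityʳ _ ⟨
    (ι a - ι b) + 0#              ≈⟨ +-congˡ (-‿inverseʳ (ι b′)) ⟨
    (ι a - ι b) + (ι b′ - ι b′)   ≈⟨ difference-+ _ _ _ _ ⟨
    (ι a + ι b′) - (ι b + ι b′)   ≈⟨ +-congʳ cross ⟩
    (ι a′ + ι b) - (ι b + ι b′)   ≈⟨ +-congˡ (-‿cong (+-comm _ _)) ⟩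
    (ι a′ + ι b) - (ι b′ + ι b)   ≈⟨ difference-+ _ _ _ _ ⟩
    (ι a′ - ι b′) + (ι b - ι b)   ≈⟨ +-congˡ (-‿inverseʳ (ι b)) ⟩
    (ι a′ - ι b′) + 0#            ≈⟨ +-identityʳ _ ⟩
    ι a′ - ι b′                   ≈⟨ eval-difference a′ b′ ⟨
    eval (a′ , b′)                ∎)
    where
    cross : ι a + ι b′ ≈ ι a′ + ι b
    cross = begin
      ι a + ι b′      ≈⟨ ×-homo-+ 1# a b′ ⟨
      ι (a ℕ.+ b′)    ≡⟨ ≡.cong ι eq ⟩
      ι (a′ ℕ.+ b)    ≈⟨ ×-homo-+ 1# a′ b ⟩
      ι a′ + ι b      ∎

  open import Algebra.Solver.Ring coefficients (fromCommutativeRing R) morphism eval-≟ public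
    using (Polynomial; solve; con; _:=_; _:+_; _:*_; _:-_; :-_)

  :0 :1 : ∀ {n} → Polynomial n
  :0 = con (0 , 0)
  :1 = con (1 , 0)

  vanish : ∀ {l r} k → l ≈ r → k * (l - r) ≈ 0#
  vanish {l} {r} k eq = trans (*-congˡ (trans (+-congʳ eq) (-‿inverseʳ r))) (zeroʳ k)

  -- x ≈ y by a linear combination of the given equations with coefficients kᵢ.
  combine₁ : ∀ {x y l r} k → l ≈ r → x ≈ y + k * (l - r) → x ≈ y
  combine₁ k eq p = trans p (trans (+-congˡ (vanish k eq)) (+-identityʳ _))

  combine₂ : ∀ {x y l₁ r₁ l₂ r₂} k₁ k₂ → l₁ ≈ r₁ → l₂ ≈ r₂ →
             x ≈ y + k₁ * (l₁ - r₁) + k₂ * (l₂ - r₂) → x ≈ y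
  combine₂ k₁ k₂ eq₁ eq₂ p = combine₁ k₁ eq₁ (combine₁ k₂ eq₂ p)

  combine₃ : ∀ {x y l₁ r₁ l₂ r₂ l₃ r₃} k₁ k₂ k₃ → l₁ ≈ r₁ → l₂ ≈ r₂ → l₃ ≈ r₃ →
             x ≈ y + k₁ * (l₁ - r₁) + k₂ * (l₂ - r₂) + k₃ * (l₃ - r₃) → x ≈ y
  combine₃ k₁ k₂ k₃ eq₁ eq₂ eq₃ p = combine₂ k₁ k₂ eq₁ eq₂ (combine₁ k₃ eq₃ p)

-- Units, finite sums and basis vectors.

module Basics {c ℓ} (R : CommutativeRing c ℓ) where
  open CommutativeRing R hiding (zero)
  open Orth R
  open IntegerSolver R

  IsHalf : Carrier → Set ℓ
  IsHalf h = h + h ≈ 1#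

  Symmetric : ∀ {n} → Matrix n → Set ℓ
  Symmetric S = ∀ i j → S i j ≈ S j i

  unit-1 : IsUnit 1#
  unit-1 = 1# , *-identityˡ 1#

  unit-* : ∀ {x y} → IsUnit x → IsUnit y → IsUnit (x * y)
  unit-* {x} {y} (x′ , xx′) (y′ , yy′) = x′ * y′ ,
    combine₂ _ _ xx′ yy′ (solve 4 (λ x y x′ y′ → x :* y :* (x′ :* y′)
        := :1 :+ (y :* y′) :* (x :* x′ :- :1) :+ :1 :* (y :* y′ :- :1)) refl _ _ _ _)

  sum-cong : ∀ n {f g : Vector n} → (∀ i → f i ≈ g i) → sumF n f ≈ sumF n g
  sum-cong zero eq = refl
  sum-cong (suc n) eq = +-cong (eq Fin.zero) (sum-cong n (λ i → eq (Fin.suc i)))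

  sum-0 : ∀ n → sumF n (λ _ → 0#) ≈ 0#
  sum-0 zero = refl
  sum-0 (suc n) = trans (+-identityˡ _) (sum-0 n)

  sum-+ : ∀ n (f g : Vector n) → sumF n (λ i → f i + g i) ≈ sumF n f + sumF n g
  sum-+ zero f g = sym (+-identityˡ _)
  sum-+ (suc n) f g = trans (+-congˡ (sum-+ n _ _)) (solve 4 (λ a b c d → (a :+ b) :+ (c :+ d)
      := (a :+ c) :+ (b :+ d)) refl _ _ _ _)

  sum-*ˡ : ∀ n t (f : Vector n) → sumF n (λ i → t * f i) ≈ t * sumF n f
  sum-*ˡ zero t f = sym (zeroʳ t)
  sum-*ˡ (suc n) t f = trans (+-congˡ (sum-*ˡ n t _)) (sym (distribˡ t _ _))

  sum-*ʳ : ∀ n t (f : Vector n) → sumF n (λ i → f i * t) ≈ sumF n f * t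
  sum-*ʳ n t f = trans (sum-cong n (λ i → *-comm _ _)) (trans (sum-*ˡ n t f) (*-comm _ _))

  sum-swap : ∀ m n (f : Fin m → Fin n → Carrier) →
             sumF m (λ i → sumF n (f i)) ≈ sumF n (λ j → sumF m (λ i → f i j))
  sum-swap zero n f = sym (sum-0 n)
  sum-swap (suc m) n f = trans (+-congˡ (sum-swap m n _)) (sym (sum-+ n (f Fin.zero) _))

  -- `Fin` counts from 0 and `e` from 1. Raising both indices leaves the entry unchanged by
  -- computation, which drives the inductions below.
  basis : ∀ {n} → Fin n → Vector n
  basis i = e (suc (toℕ i))

  sum-basisʳ : ∀ {n} (f : Vector n) k → sumF n (λ i → f i * basis k i) ≈ f k
  sum-basisʳ {suc n} f Fin.zero = trans (+-cong (*-identityʳ _) (trans (sum-cong n (λ i → zeroʳ _))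
      (sum-0 n))) (+-identityʳ _)
  sum-basisʳ {suc n} f (Fin.suc k) = trans (+-cong (zeroʳ _) (sum-basisʳ _ k)) (+-identityˡ _)

  basis-sym : ∀ {n} (i k : Fin n) → basis i k ≈ basis k i
  basis-sym Fin.zero Fin.zero = refl
  basis-sym Fin.zero (Fin.suc k) = refl
  basis-sym (Fin.suc i) Fin.zero = refl
  basis-sym (Fin.suc i) (Fin.suc k) = basis-sym i k

  sum-basis : ∀ {n} (f : Vector n) k → sumF n (λ i → f i * basis i k) ≈ f k
  sum-basis {n} f k = trans (sum-cong n (λ i → *-congˡ (basis-sym i k))) (sum-basisʳ f k)

-- Symmetric bilinear forms and isometries that correct the identity in two directions.

module Forms {c ℓ} (R : CommutativeRing c ℓ) {n : ℕ} (S : Orth.Matrix R n)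
             (S-sym : Basics.Symmetric R S) where
  open CommutativeRing R hiding (zero)
  open Orth R
  open IntegerSolver R
  open Basics R

  V : Set c
  V = Vector n

  B : V → V → Carrier
  B = form S

  lc : V → Carrier → V → Carrier → V → V
  lc v a x b y i = v i + a * x i + b * y i

  infixr 8 _∙_
  _∙_ : Carrier → V → V
  (t ∙ x) i = t * x i

  infixl 6 _⊕_
  _⊕_ : V → V → V
  (x ⊕ y) i = x i + y i

  0ᵥ : V
  0ᵥ _ = 0#

  ≋-trans : {x y z : V} → x ≋ y → y ≋ z → x ≋ z
  ≋-trans p q i = trans (p i) (q i)

  ≋-sym : {x y : V} → x ≋ y → y ≋ x
  ≋-sym p i = sym (p i)

  B-cong : ∀ {x x′ y y′} → x ≋ x′ → y ≋ y′ → B x y ≈ B x′ y′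
  B-cong p q = sum-cong n (λ i → sum-cong n (λ j → *-cong (*-congʳ (p i)) (q j)))

  B-sym : ∀ x y → B x y ≈ B y x
  B-sym x y = trans (sum-swap n n _) (sum-cong n (λ j → sum-cong n (λ i →
    trans (*-congʳ (*-congˡ (S-sym i j))) (solve 3 (λ a b c → a :* b :* c := c :* b :* a) refl _ _ _))))

  B-⊕ˡ : ∀ x y w → B (x ⊕ y) w ≈ B x w + B y w
  B-⊕ˡ x y w = trans (sum-cong n (λ i → trans
    (sum-cong n (λ j → solve 4 (λ a b c d → (a :+ b) :* c :* d := a :* c :* d :+ b :* c :* d) refl _ _ _ _))
        (sum-+ n _ _))) (sum-+ n _ _)

  B-∙ˡ : ∀ t x w → B (t ∙ x) w ≈ t * B x w
  B-∙ˡ t x w = trans (sum-cong n (λ i → trans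
    (sum-cong n (λ j → solve 4 (λ a b c d → a :* b :* c :* d := a :* (b :* c :* d)) refl _ _ _ _))
        (sum-*ˡ n t _))) (sum-*ˡ n t _)

  B-⊕ʳ : ∀ w x y → B w (x ⊕ y) ≈ B w x + B w y
  B-⊕ʳ w x y = trans (B-sym _ _) (trans (B-⊕ˡ x y w) (+-cong (B-sym _ _) (B-sym _ _)))

  B-∙ʳ : ∀ w t x → B w (t ∙ x) ≈ t * B w x
  B-∙ʳ w t x = trans (B-sym _ _) (trans (B-∙ˡ t x w) (*-congˡ (B-sym _ _)))

  B-lcˡ : ∀ v a x b y w → B (lc v a x b y) w ≈ B v w + a * B x w + b * B y w
  B-lcˡ v a x b y w = trans (B-⊕ˡ (v ⊕ a ∙ x) (b ∙ y) w)
    (+-cong (trans (B-⊕ˡ v (a ∙ x) w) (+-congˡ (B-∙ˡ a x w))) (B-∙ˡ b y w))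

  B-lcʳ : ∀ w v a x b y → B w (lc v a x b y) ≈ B w v + a * B w x + b * B w y
  B-lcʳ w v a x b y = trans (B-sym _ _) (trans (B-lcˡ v a x b y w)
    (+-cong (+-cong (B-sym _ _) (*-congˡ (B-sym _ _))) (*-congˡ (B-sym _ _))))

  B-basisˡ : ∀ k y → B (basis k) y ≈ sumF n (λ j → S k j * y j)
  B-basisˡ k y = trans (sum-cong n (λ i → trans
      (sum-cong n (λ j → solve 3 (λ a b c → a :* b :* c := (b :* c) :* a) refl _ _ _))
          (sum-*ʳ n (basis k i) _)))
    (sum-basisʳ (λ i → sumF n (λ j → S i j * y j)) k)

  B-basis : ∀ i j → B (basis i) (basis j) ≈ S i j
  B-basis i j = trans (B-basisˡ i (basis j)) (sum-basisʳ (S i) j)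

  -- Linear maps in place of matrices, so that composites need no matrix algebra. `matrix` recovers
  -- T at the end; its rows are the images of the basis because vectors are rows.
  record Isometry : Set (c ⊔ ℓ) where
    field
      map : V → V
      map-cong : ∀ {x y} → x ≋ y → map x ≋ map y
      map-⊕ : ∀ x y → map (x ⊕ y) ≋ (map x ⊕ map y)
      map-∙ : ∀ t x → map (t ∙ x) ≋ (t ∙ map x)
      map-B : ∀ x y → B (map x) (map y) ≈ B x y

    map-sum : ∀ {m} (t : Vector m) (x : Fin m → V) →
              map (λ k → sumF m (λ i → t i * x i k)) ≋ (λ k → sumF m (λ i → t i * map (x i) k))
    -- The empty sum is rewritten as `0# ∙ 0ᵥ`, so homogeneity alone yields its image.
    map-sum {zero} t x k = trans (map-cong (λ _ → sym (zeroˡ 0#)) k)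
                             (trans (map-∙ 0# 0ᵥ k) (zeroˡ _))
    map-sum {suc m} t x k = trans (map-⊕ (t Fin.zero ∙ x Fin.zero) _ k)
      (+-cong (map-∙ _ _ k) (map-sum (λ i → t (Fin.suc i)) (λ i → x (Fin.suc i)) k))

    matrix : Matrix n
    matrix i = map (basis i)

    ·M-matrix : ∀ x → (x ·M matrix) ≋ map x
    ·M-matrix x k = trans (sym (map-sum x basis k)) (map-cong (sum-basis x) k)

    -- Up to the order of summation, the entry (i , j) of T S Tᵗ is `B` applied to the rows i and j
    -- of T.
    matrix-orthogonal : ∀ i j → ((matrix ⊗ S) ⊗ tr matrix) i j ≈ S i j
    matrix-orthogonal i j = trans (sum-cong n (λ l → sym (sum-*ʳ n _ _)))
      (trans (sum-swap n n _) (trans (map-B (basis i) (basis j)) (B-basis i j)))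

  open Isometry public

  id-isometry : Isometry
  id-isometry = record
    { map = λ x → x ; map-cong = λ p → p ; map-⊕ = λ _ _ _ → refl
    ; map-∙ = λ _ _ _ → refl ; map-B = λ _ _ → refl }

  infixr 9 _⊚_
  _⊚_ : Isometry → Isometry → Isometry
  φ ⊚ ψ = record
    { map = λ x → map φ (map ψ x)
    ; map-cong = λ p → map-cong φ (map-cong ψ p)
    ; map-⊕ = λ x y → ≋-trans (map-cong φ (map-⊕ ψ x y)) (map-⊕ φ _ _)
    ; map-∙ = λ t x → ≋-trans (map-cong φ (map-∙ ψ t x)) (map-∙ φ _ _)
    ; map-B = λ x y → trans (map-B φ _ _) (map-B ψ x y) }

  map-lc : ∀ φ v a x b y → map φ (lc v a x b y) ≋ lc (map φ v) a (map φ x) b (map φ y)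
  map-lc φ v a x b y i = trans (map-⊕ φ (v ⊕ a ∙ x) (b ∙ y) i)
    (+-cong (trans (map-⊕ φ v (a ∙ x) i) (+-congˡ (map-∙ φ a x i))) (map-∙ φ b y i))

  -- Eichler transformations, reflections and rescalings of a hyperbolic plane are all special
  -- cases, differing only in the four coefficients.
  Φ : (x y : V) (a₁ a₂ b₁ b₂ : Carrier) → V → V
  Φ x y a₁ a₂ b₁ b₂ v = lc v (a₁ * B v x + a₂ * B v y) x (b₁ * B v x + b₂ * B v y) y

  -- Writing M = (a₁ a₂; b₁ b₂) and G for the Gram matrix of x and y, the equations say
  -- M + Mᵗ + Mᵗ G M = 0, i.e. that Φ with the transposed coefficients is left inverse to Φ.
  record Adjoint (x y : V) (a₁ a₂ b₁ b₂ : Carrier) : Set ℓ where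
    field
      eq₁₁ : a₁ + a₁ + (a₁ * a₁ * B x x + (a₁ * b₁ + a₁ * b₁) * B x y + b₁ * b₁ * B y y) ≈ 0#
      eq₂₂ : b₂ + b₂ + (a₂ * a₂ * B x x + (a₂ * b₂ + a₂ * b₂) * B x y + b₂ * b₂ * B y y) ≈ 0#
      eq₁₂ : a₂ + b₁ + (a₁ * a₂ * B x x + (a₁ * b₂ + a₂ * b₁) * B x y + b₁ * b₂ * B y y) ≈ 0#

  module _ {x y : V} {a₁ a₂ b₁ b₂ : Carrier} (adj : Adjoint x y a₁ a₂ b₁ b₂) where
    open Adjoint adj

    -- The change in `B` is the bilinear form with matrix M + Mᵗ + Mᵗ G M, taken at (B v x , B v y)
    -- and (B w x , B w y); these values supply the three multipliers of the equations.
    Φ-B : ∀ v w → B (Φ x y a₁ a₂ b₁ b₂ v) (Φ x y a₁ a₂ b₁ b₂ w) ≈ B v w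
    Φ-B v w = trans (B-lcˡ v _ x _ y _) (trans (+-cong (+-cong (B-lcʳ v w _ x _ y)
        (*-congˡ (trans (B-lcʳ x w _ x _ y) (+-congʳ (+-congʳ (B-sym x w))))))
        (*-congˡ (trans (B-lcʳ y w _ x _ y) (+-cong (+-cong (B-sym y w) (*-congˡ (B-sym y x))) refl))))
      (combine₃ (B v x * B w x) (B v y * B w y) (B v x * B w y + B v y * B w x) eq₁₁ eq₂₂ eq₁₂
        (solve 12 (λ vw vx vy wx wy xx xy yy a₁ a₂ b₁ b₂ → vw :+ (a₁ :* wx :+ a₂ :* wy) :* vx
            :+ (b₁ :* wx :+ b₂ :* wy) :* vy
            :+ (a₁ :* vx :+ a₂ :* vy) :* (wx :+ (a₁ :* wx :+ a₂ :* wy) :* xx :+ (b₁ :* wx :+ b₂ :* wy) :* xy)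
            :+ (b₁ :* vx :+ b₂ :* vy) :* (wy :+ (a₁ :* wx :+ a₂ :* wy) :* xy :+ (b₁ :* wx :+ b₂ :* wy) :* yy)
          := vw :+ (vx :* wx) :* (a₁ :+ a₁ :+ (a₁ :* a₁ :* xx :+ (a₁ :* b₁ :+ a₁ :* b₁) :* xy
              :+ b₁ :* b₁ :* yy) :- :0)
               :+ (vy :* wy) :* (b₂ :+ b₂ :+ (a₂ :* a₂ :* xx :+ (a₂ :* b₂ :+ a₂ :* b₂) :* xy
                   :+ b₂ :* b₂ :* yy) :- :0)
               :+ (vx :* wy :+ vy :* wx) :* (a₂ :+ b₁ :+ (a₁ :* a₂ :* xx :+ (a₁ :* b₂ :+ a₂ :* b₁) :* xy
                   :+ b₁ :* b₂ :* yy) :- :0)) refl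
          _ _ _ _ _ _ _ _ _ _ _ _)))

    Φ-isometry : Isometry
    Φ-isometry = record
      { map = Φ x y a₁ a₂ b₁ b₂
      ; map-cong = λ p i → +-cong
          (+-cong (p i) (*-congʳ (+-cong (*-congˡ (B-cong p (λ _ → refl)))
          (*-congˡ (B-cong p (λ _ → refl))))))
                                  (*-congʳ (+-cong (*-congˡ (B-cong p (λ _ → refl)))
                                      (*-congˡ (B-cong p (λ _ → refl)))))
      ; map-⊕ = λ v w i → trans
          (+-cong (+-congˡ (*-congʳ (+-cong (*-congˡ (B-⊕ˡ v w x)) (*-congˡ (B-⊕ˡ v w y)))))
                  (*-congʳ (+-cong (*-congˡ (B-⊕ˡ v w x)) (*-congˡ (B-⊕ˡ v w y)))))
          (solve 12 (λ v w vx vy wx wy xi yi a₁ a₂ b₁ b₂ → (v :+ w)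
              :+ (a₁ :* (vx :+ wx) :+ a₂ :* (vy :+ wy)) :* xi :+ (b₁ :* (vx :+ wx) :+ b₂ :* (vy :+ wy)) :* yi
             := (v :+ (a₁ :* vx :+ a₂ :* vy) :* xi :+ (b₁ :* vx :+ b₂ :* vy) :* yi)
               :+ (w :+ (a₁ :* wx :+ a₂ :* wy) :* xi :+ (b₁ :* wx :+ b₂ :* wy) :* yi)) refl _ _ _ _ _ _ _ _ _
                   _ _ _)
      ; map-∙ = λ t v i → trans
          (+-cong (+-congˡ (*-congʳ (+-cong (*-congˡ (B-∙ˡ t v x)) (*-congˡ (B-∙ˡ t v y)))))
                  (*-congʳ (+-cong (*-congˡ (B-∙ˡ t v x)) (*-congˡ (B-∙ˡ t v y)))))
          (solve 10 (λ t v vx vy xi yi a₁ a₂ b₁ b₂ → t :* v :+ (a₁ :* (t :* vx) :+ a₂ :* (t :* vy)) :* xi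
              :+ (b₁ :* (t :* vx) :+ b₂ :* (t :* vy)) :* yi
             := t :* (v :+ (a₁ :* vx :+ a₂ :* vy) :* xi :+ (b₁ :* vx :+ b₂ :* vy) :* yi)) refl _ _ _ _ _ _ _ _
                 _ _)
      ; map-B = Φ-B }

    Φ-inverse : ∀ v → Φ x y a₁ b₁ a₂ b₂ (Φ x y a₁ a₂ b₁ b₂ v) ≋ v
    Φ-inverse v i = trans (+-cong (+-congˡ (*-congʳ (+-cong (*-congˡ vx′) (*-congˡ vy′))))
                                  (*-congʳ (+-cong (*-congˡ vx′) (*-congˡ vy′))))
      (combine₃ (B v x * x i) (B v y * y i) (B v y * x i + B v x * y i) eq₁₁ eq₂₂ eq₁₂
        (solve 12 (λ v vx vy xi yi xx xy yy a₁ a₂ b₁ b₂ → (v :+ (a₁ :* vx :+ a₂ :* vy) :* xi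
            :+ (b₁ :* vx :+ b₂ :* vy) :* yi)
            :+ (a₁ :* (vx :+ (a₁ :* vx :+ a₂ :* vy) :* xx :+ (b₁ :* vx :+ b₂ :* vy) :* xy)
               :+ b₁ :* (vy :+ (a₁ :* vx :+ a₂ :* vy) :* xy :+ (b₁ :* vx :+ b₂ :* vy) :* yy)) :* xi
            :+ (a₂ :* (vx :+ (a₁ :* vx :+ a₂ :* vy) :* xx :+ (b₁ :* vx :+ b₂ :* vy) :* xy)
               :+ b₂ :* (vy :+ (a₁ :* vx :+ a₂ :* vy) :* xy :+ (b₁ :* vx :+ b₂ :* vy) :* yy)) :* yi
          := v :+ (vx :* xi) :* (a₁ :+ a₁ :+ (a₁ :* a₁ :* xx :+ (a₁ :* b₁ :+ a₁ :* b₁) :* xy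
              :+ b₁ :* b₁ :* yy) :- :0)
              :+ (vy :* yi) :* (b₂ :+ b₂ :+ (a₂ :* a₂ :* xx :+ (a₂ :* b₂ :+ a₂ :* b₂) :* xy :+ b₂ :* b₂ :* yy)
                  :- :0)
              :+ (vy :* xi :+ vx :* yi) :* (a₂ :+ b₁ :+ (a₁ :* a₂ :* xx :+ (a₁ :* b₂ :+ a₂ :* b₁) :* xy
                  :+ b₁ :* b₂ :* yy) :- :0)) refl
          _ _ _ _ _ _ _ _ _ _ _ _))
      where
      vx′ = trans (B-lcˡ v (a₁ * B v x + a₂ * B v y) x (b₁ * B v x + b₂ * B v y) y x)
          (+-congˡ (*-congˡ (B-sym y x)))
      vy′ = B-lcˡ v (a₁ * B v x + a₂ * B v y) x (b₁ * B v x + b₂ * B v y) y y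

    Φ-fixes : ∀ {v} → B v x ≈ 0# → B v y ≈ 0# → Φ x y a₁ a₂ b₁ b₂ v ≋ v
    Φ-fixes {v} p q i = trans (+-cong (+-congˡ (*-congʳ (+-cong (*-congˡ p) (*-congˡ q))))
                                      (*-congʳ (+-cong (*-congˡ p) (*-congˡ q))))
      (solve 7 (λ v xi yi a₁ a₂ b₁ b₂ → v :+ (a₁ :* :0 :+ a₂ :* :0) :* xi :+ (b₁ :* :0 :+ b₂ :* :0) :* yi
          := v) refl _ _ _ _ _ _ _)

-- Eichler transformations, rescalings, reflections, and the moves that fix [e₁].

module Moves {c ℓ} (R : CommutativeRing c ℓ) {n : ℕ} (S : Orth.Matrix R n)
             (S-sym : Basics.Symmetric R S)
             (h : CommutativeRing.Carrier R)
             (h+h≈1 : Basics.IsHalf R h) where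
  open CommutativeRing R hiding (zero)
  open Orth R
  open IntegerSolver R
  open Basics R
  open Forms R S S-sym

  2h≈ : ∀ x → h * x + h * x ≈ x
  2h≈ x = combine₁ x h+h≈1 (solve 2 (λ h x → h :* x :+ h :* x := x :+ x :* (h :+ h :- :1)) refl h x)

  halve : ∀ {x y} → x + x ≈ y + y → x ≈ y
  halve {x} {y} eq = trans (sym (2h≈ x))
      (trans (trans (sym (distribˡ h x x)) (trans (*-congˡ eq) (distribˡ h y y))) (2h≈ y))

  record Hyperbolic (x y : V) : Set ℓ where
    field
      xx≈0 : B x x ≈ 0#
      yy≈0 : B y y ≈ 0#
      xy≈1 : B x y ≈ 1#

    yx≈1 : B y x ≈ 1#
    yx≈1 = trans (B-sym y x) xy≈1

  open Hyperbolic

  module _ {x y : V} (xx : B x x ≈ 0#) (xy : B x y ≈ 0#) where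
    -- The coefficients give v ↦ v + (B(v,y) - ½ B(y,y) B(v,x)) x - B(v,x) y; the summand with ½
    -- compensates the norm contributed by the term in y.
    eichler⁺ : Adjoint x y (- (h * B y y)) 1# (- 1#) 0#
    eichler⁺ = record
      { eq₁₁ = combine₃ _ _ (- B y y) xx xy h+h≈1
          (solve 4 (λ h xx xy yy → :- (h :* yy) :+ :- (h :* yy) :+ (:- (h :* yy) :* :- (h :* yy) :* xx
              :+ (:- (h :* yy) :* :- :1 :+ :- (h :* yy) :* :- :1) :* xy :+ :- :1 :* :- :1 :* yy)
            := :0 :+ (h :* yy :* (h :* yy)) :* (xx :- :0) :+ (h :* yy :+ h :* yy) :* (xy :- :0)
                :+ (:- yy) :* (h :+ h :- :1)) refl _ _ _ _)
      ; eq₂₂ = combine₁ _ xx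
          (solve 3 (λ xx xy yy → :0 :+ :0 :+ (:1 :* :1 :* xx :+ (:1 :* :0 :+ :1 :* :0) :* xy
          :+ :0 :* :0 :* yy) := :0 :+ :1 :* (xx :- :0)) refl _ _ _)
      ; eq₁₂ = combine₂ _ _ xx xy (solve 4 (λ h xx xy yy → :1 :+ :- :1 :+ (:- (h :* yy) :* :1 :* xx
          :+ (:- (h :* yy) :* :0 :+ :1 :* :- :1) :* xy :+ :- :1 :* :0 :* yy)
            := :0 :+ (:- (h :* yy)) :* (xx :- :0) :+ (:- :1) :* (xy :- :0)) refl _ _ _ _)
      }

    -- The transposed coefficients, which amount to replacing y by -y: this is the inverse of the
    -- transformation given by `eichler⁺`.
    eichler⁻ : Adjoint x y (- (h * B y y)) (- 1#) 1# 0#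
    eichler⁻ = record
      { eq₁₁ = combine₃ _ _ (- B y y) xx xy h+h≈1
          (solve 4 (λ h xx xy yy → :- (h :* yy) :+ :- (h :* yy) :+ (:- (h :* yy) :* :- (h :* yy) :* xx
              :+ (:- (h :* yy) :* :1 :+ :- (h :* yy) :* :1) :* xy :+ :1 :* :1 :* yy)
            := :0 :+ (h :* yy :* (h :* yy)) :* (xx :- :0) :+ (:- (h :* yy) :+ :- (h :* yy)) :* (xy :- :0)
                :+ (:- yy) :* (h :+ h :- :1)) refl _ _ _ _)
      ; eq₂₂ = combine₁ _ xx
          (solve 3 (λ xx xy yy → :0 :+ :0 :+ (:- :1 :* :- :1 :* xx :+ (:- :1 :* :0 :+ :- :1 :* :0) :* xy
          :+ :0 :* :0 :* yy) := :0 :+ :1 :* (xx :- :0)) refl _ _ _)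
      ; eq₁₂ = combine₂ _ _ xx xy (solve 4 (λ h xx xy yy → :- :1 :+ :1 :+ (:- (h :* yy) :* :- :1 :* xx
          :+ (:- (h :* yy) :* :0 :+ :- :1 :* :1) :* xy :+ :1 :* :0 :* yy)
            := :0 :+ (h :* yy) :* (xx :- :0) :+ (:- :1) :* (xy :- :0)) refl _ _ _ _)
      }

  -- The map sends x to u x and y to v y and fixes everything orthogonal to both; u v = 1 keeps
  -- B(x,y) = 1.
  scaling : ∀ {x y u v} → Hyperbolic x y → u * v ≈ 1# → Adjoint x y 0# (u - 1#) (v - 1#) 0#
  scaling {x} {y} {u} {v} H uv = record
    { eq₁₁ = combine₁ _ (yy≈0 H)
        (solve 4 (λ v xx xy yy → :0 :+ :0 :+ (:0 :* :0 :* xx :+ (:0 :* (v :- :1) :+ :0 :* (v :- :1)) :* xy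
        :+ (v :- :1) :* (v :- :1) :* yy)
        := :0 :+ ((v :- :1) :* (v :- :1)) :* (yy :- :0)) refl _ _ _ _)
    ; eq₂₂ = combine₁ _ (xx≈0 H) (solve 4 (λ v xx xy yy → :0 :+ :0 :+ ((v :- :1) :* (v :- :1) :* xx
        :+ ((v :- :1) :* :0 :+ (v :- :1) :* :0) :* xy :+ :0 :* :0 :* yy)
        := :0 :+ ((v :- :1) :* (v :- :1)) :* (xx :- :0)) refl _ _ _ _)
    ; eq₁₂ = combine₂ _ _ (xy≈1 H) uv (solve 5 (λ u v xx xy yy → u :- :1 :+ (v :- :1)
        :+ (:0 :* (u :- :1) :* xx :+ (:0 :* :0 :+ (u :- :1) :* (v :- :1)) :* xy :+ (v :- :1) :* :0 :* yy)
        := :0 :+ ((u :- :1) :* (v :- :1)) :* (xy :- :1) :+ :1 :* (u :* v :- :1)) refl _ _ _ _ _)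
    }

  -- `q` inverts the norm of x, so -(q + q) is the usual -2/B(x,x). Taking y = x fits a correction
  -- in one direction into the family with two.
  reflection : ∀ {x q} → B x x * q ≈ 1# → Adjoint x x (- (q + q)) 0# 0# 0#
  reflection {x} {q} xxq = record
    { eq₁₁ = combine₁ _ xxq (solve 2 (λ q xx → :- (q :+ q) :+ :- (q :+ q) :+ (:- (q :+ q) :* :- (q :+ q) :* xx
        :+ (:- (q :+ q) :* :0 :+ :- (q :+ q) :* :0) :* xx :+ :0 :* :0 :* xx)
        := :0 :+ ((q :+ q) :+ (q :+ q)) :* (xx :* q :- :1)) refl _ _)
    ; eq₂₂ = solve 1 (λ xx → :0 :+ :0 :+ (:0 :* :0 :* xx :+ (:0 :* :0 :+ :0 :* :0) :* xx :+ :0 :* :0 :* xx)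
        := :0) refl _
    ; eq₁₂ = solve 2 (λ a xx → :0 :+ :0 :+ (a :* :0 :* xx :+ (a :* :0 :+ :0 :* :0) :* xx :+ :0 :* :0 :* xx)
        := :0) refl _ _
    }

  ≋⇒∼ : {α β : V} → α ≋ β → α ∼ β
  ≋⇒∼ eq = 1# , unit-1 , λ i → trans (eq i) (sym (*-identityˡ _))

  ∼-trans : {α β γ : V} → α ∼ β → β ∼ γ → α ∼ γ
  ∼-trans (u , uu , p) (v , vu , q) = u * v , unit-* uu vu ,
    λ i → trans (p i) (trans (*-congˡ (q i)) (sym (*-assoc u v _)))

  map-∼ : ∀ φ {α β} → α ∼ β → map φ α ∼ map φ β
  map-∼ φ (u , uu , p) = u , uu , ≋-trans (map-cong φ p) (map-∙ φ u _)

  module Stabilizer {e₁ f₁ : V} (H₁ : Hyperbolic e₁ f₁) where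

    infix 4 _↝_ _⇝_

    -- The isometry runs from β to α, as `OrbitClaim` demands. It fixes e₁ only up to a unit because
    -- `hyp-scale` multiplies e₁ by one.
    record _↝_ (α β : V) : Set (c ⊔ ℓ) where
      field
        isometry : Isometry
        fixes : map isometry e₁ ∼ e₁
        reaches : α ∼ map isometry β

    open _↝_ public

    ↝-trans : ∀ {α β γ} → α ↝ β → β ↝ γ → α ↝ γ
    ↝-trans p q = record
      { isometry = isometry p ⊚ isometry q
      ; fixes = ∼-trans (map-∼ (isometry p) (fixes q)) (fixes p)
      ; reaches = ∼-trans (reaches p) (map-∼ (isometry p) (reaches q)) }

    ∼⇒↝ : ∀ {α β} → α ∼ β → α ↝ β
    ∼⇒↝ p = record { isometry = id-isometry ; fixes = ≋⇒∼ (λ _ → refl) ; reaches = p }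

    ≋⇒↝ : ∀ {α β} → α ≋ β → α ↝ β
    ≋⇒↝ p = ∼⇒↝ (≋⇒∼ p)

    ↝-B : ∀ {α β} → α ↝ β → B α α ≈ 0# → B β β ≈ 0#
    ↝-B {α} {β} p αα with reaches p
    ... | u , (v , uv) , eq = trans (sym (map-B φ β β))
        (combine₂ _ _ uv (trans (sym αα) (trans (B-cong eq eq) (trans (B-∙ˡ u _ _) (*-congˡ (B-∙ʳ _ u _)))))
          (solve 3 (λ u v q → q := :0 :+ (:- (q :* (u :* v :+ :1))) :* (u :* v :- :1)
              :+ (:- (v :* v)) :* (:0 :- u :* (u :* q))) refl u v _))
      where φ = isometry p

    Perp : V → Set ℓ
    Perp w = B w e₁ ≈ 0# × B w f₁ ≈ 0#

    Perp-lc : ∀ {v x y} a b → Perp v → Perp x → Perp y → Perp (lc v a x b y)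
    Perp-lc {v} {x} {y} a b (p , p′) (q , q′) (r , r′) =
      trans (B-lcˡ v a x b y e₁) (combine₃ _ _ _ p q r (solve 5 (λ a b p q r → p :+ a :* q :+ b :* r
          := :0 :+ :1 :* (p :- :0) :+ a :* (q :- :0) :+ b :* (r :- :0)) refl _ _ _ _ _)) ,
      trans (B-lcˡ v a x b y f₁) (combine₃ _ _ _ p′ q′ r′ (solve 5 (λ a b p q r → p :+ a :* q :+ b :* r
          := :0 :+ :1 :* (p :- :0) :+ a :* (q :- :0) :+ b :* (r :- :0)) refl _ _ _ _ _))

    Perp-∙ : ∀ {x} t → Perp x → Perp (t ∙ x)
    Perp-∙ {x} t (p , q) = trans (B-∙ˡ t x e₁) (trans (*-congˡ p) (zeroʳ t)) , trans (B-∙ˡ t x f₁)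
        (trans (*-congˡ q) (zeroʳ t))

    hyp : Carrier → Carrier → V → V
    hyp a b w = lc w a e₁ b f₁

    hyp-cong : ∀ {a a′ b b′ w w′} → a ≈ a′ → b ≈ b′ → w ≋ w′ → hyp a b w ≋ hyp a′ b′ w′
    hyp-cong p q r i = +-cong (+-cong (r i) (*-congʳ p)) (*-congʳ q)

    -- In a hyperbolic pair the coefficient of e₁ is read off by f₁, and that of f₁ by e₁.
    proj : V → V
    proj α = lc α (- B α f₁) e₁ (- B α e₁) f₁

    proj-perp : ∀ α → Perp (proj α)
    proj-perp α =
      trans (B-lcˡ α _ e₁ _ f₁ e₁) (combine₂ _ _ (xx≈0 H₁) (yx≈1 H₁)
        (solve 4 (λ a b ee fe → b :+ :- a :* ee :+ :- b :* fe
            := :0 :+ (:- a) :* (ee :- :0) :+ (:- b) :* (fe :- :1)) refl _ _ _ _)) ,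
      trans (B-lcˡ α _ e₁ _ f₁ f₁) (combine₂ _ _ (xy≈1 H₁) (yy≈0 H₁)
        (solve 4 (λ a b ef ff → a :+ :- a :* ef :+ :- b :* ff
            := :0 :+ (:- a) :* (ef :- :1) :+ (:- b) :* (ff :- :0)) refl _ _ _ _))

    proj-decompose : ∀ α → α ≋ hyp (B α f₁) (B α e₁) (proj α)
    proj-decompose α i = solve 5 (λ v a b e f → v := (v :+ :- a :* e :+ :- b :* f) :+ a :* e :+ b :* f) refl _
        _ _ _ _

    module _ {w : V} (w⊥ : Perp w) (a b : Carrier) where
      hyp-e₁ : B (hyp a b w) e₁ ≈ b
      hyp-e₁ = trans (B-lcˡ w a e₁ b f₁ e₁) (combine₃ _ _ _ (proj₁ w⊥) (xx≈0 H₁) (yx≈1 H₁)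
        (solve 5 (λ a b we ee fe → we :+ a :* ee :+ b :* fe
            := b :+ :1 :* (we :- :0) :+ a :* (ee :- :0) :+ b :* (fe :- :1)) refl _ _ _ _ _))

      hyp-f₁ : B (hyp a b w) f₁ ≈ a
      hyp-f₁ = trans (B-lcˡ w a e₁ b f₁ f₁) (combine₃ _ _ _ (proj₂ w⊥) (xy≈1 H₁) (yy≈0 H₁)
        (solve 5 (λ a b wf ef ff → wf :+ a :* ef :+ b :* ff
            := a :+ :1 :* (wf :- :0) :+ a :* (ef :- :1) :+ b :* (ff :- :0)) refl _ _ _ _ _))

      hyp-perp : ∀ {y} → Perp y → B (hyp a b w) y ≈ B w y
      hyp-perp {y} (ye , yf) = trans (B-lcˡ w a e₁ b f₁ y) (combine₂ _ _ (trans (B-sym e₁ y) ye)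
          (trans (B-sym f₁ y) yf)
        (solve 5 (λ a b wy ey fy → wy :+ a :* ey :+ b :* fy := wy :+ a :* (ey :- :0) :+ b :* (fy :- :0)) refl
            _ _ _ _ _))

      hyp-norm : B (hyp a b w) (hyp a b w) ≈ (a * b + a * b) + B w w
      hyp-norm = trans (B-lcʳ _ w a e₁ b f₁) (combine₃ _ _ _ (hyp-perp w⊥) hyp-e₁ hyp-f₁
        (solve 6 (λ a b αw αe αf ww → αw :+ a :* αe :+ b :* αf
           := (a :* b :+ a :* b) :+ ww :+ :1 :* (αw :- ww) :+ a :* (αe :- b) :+ b :* (αf :- a)) refl _ _ _ _ _
               _))

      -- The Eichler transformation along e₁ fixes e₁, keeps b and shifts w by multiples of b. For b
      -- = 1 it can remove w altogether; for a nonunit b it can still trade a against a change of w.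
      hyp-eichler : ∀ {y} → Perp y → hyp a b w ↝ hyp (a + (B w y - h * B y y * b)) b (w ⊕ (- b) ∙ y)
      hyp-eichler {y} y⊥ = record
        { isometry = Φ-isometry (eichler⁻ (xx≈0 H₁) e₁y)
        ; fixes = ≋⇒∼ (Φ-fixes (eichler⁻ (xx≈0 H₁) e₁y) (xx≈0 H₁) e₁y)
        ; reaches = ≋⇒∼ (≋-trans (≋-sym (Φ-inverse (eichler⁺ (xx≈0 H₁) e₁y) (hyp a b w)))
            (map-cong (Φ-isometry (eichler⁻ (xx≈0 H₁) e₁y)) (λ i → combine₂ _ _ hyp-e₁ (hyp-perp y⊥)
              (solve 11 (λ h w a b e f y αe αy wy yy → (w :+ a :* e :+ b :* f)
                  :+ (:- (h :* yy) :* αe :+ :1 :* αy) :* e :+ (:- :1 :* αe :+ :0 :* αy) :* y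
                 := (w :+ :- b :* y) :+ (a :+ (wy :- h :* yy :* b)) :* e :+ b :* f
                   :+ (:- (h :* yy) :* e :- y) :* (αe :- b) :+ e :* (αy :- wy)) refl h _ _ _ _ _ _ _ _ _ _))))
                       }
        where e₁y = trans (B-sym e₁ y) (proj₁ y⊥)

      -- The isometry has to lead back from the rescaled vector, so it multiplies e₁ by `v`, the
      -- inverse of `u`.
      hyp-scale : ∀ {u v} → u * v ≈ 1# → hyp a b w ↝ hyp (u * a) (v * b) w
      hyp-scale {u} {v} uv = record
        { isometry = Φ-isometry (scaling H₁ vu)
        ; fixes = v , (u , vu) , λ i → combine₂ _ _ (xx≈0 H₁) (xy≈1 H₁)
            (solve 6 (λ u v e f ee ef → e :+ (:0 :* ee :+ (v :- :1) :* ef) :* e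
                :+ ((u :- :1) :* ee :+ :0 :* ef) :* f
              := v :* e :+ ((u :- :1) :* f) :* (ee :- :0) :+ ((v :- :1) :* e) :* (ef :- :1)) refl _ _ _ _ _ _)
        ; reaches = ≋⇒∼ (≋-trans (≋-sym (Φ-inverse (scaling H₁ uv) (hyp a b w)))
            (map-cong (Φ-isometry (scaling H₁ vu)) (λ i → combine₂ _ _ hyp-e₁ hyp-f₁
              (solve 9 (λ u v w a b e f αe αf → (w :+ a :* e :+ b :* f) :+ (:0 :* αe :+ (u :- :1) :* αf) :* e
                  :+ ((v :- :1) :* αe :+ :0 :* αf) :* f
                 := w :+ (u :* a) :* e :+ (v :* b) :* f :+ ((v :- :1) :* f) :* (αe :- b)
                     :+ ((u :- :1) :* e) :* (αf :- a)) refl _ _ _ _ _ _ _ _ _)))) }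
        where vu = trans (*-comm v u) uv

    unit-hyp∼ : ∀ {a a′ b w} → a * a′ ≈ 1# → hyp a b w ∼ hyp 1# (a′ * b) (a′ ∙ w)
    unit-hyp∼ {a} {a′} {b} {w} aa′ = a , (a′ , aa′) , λ i →
      combine₁ _ aa′ (solve 6 (λ a a′ b w e f → w :+ a :* e :+ b :* f
          := a :* (a′ :* w :+ :1 :* e :+ a′ :* b :* f) :+ (:- (w :+ b :* f)) :* (a :* a′ :- :1)) refl _ _ _ _
          _ _)

    -- Divide by B(α,e₁) to get b = 1, then use the Eichler transformation with y = w, which removes
    -- w. Isotropy reads 2a + B(w,w) = 0, so the new coefficient a + ½ B(w,w) of e₁ vanishes.
    reach-f₁ : ∀ {α} → IsUnit (B α e₁) → B α α ≈ 0# → α ↝ f₁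
    reach-f₁ {α} (t , bt) αα = ↝-trans (∼⇒↝ scaled) (↝-trans (hyp-eichler w⊥ a 1# w⊥) (≋⇒↝ (λ i →
        combine₁ _ coefficient (solve 4 (λ w k e f → (w :+ :- :1 :* w) :+ k :* e :+ :1 :* f
            := f :+ e :* (k :- :0)) refl _ _ _ _))))
      where
      w = t ∙ proj α
      a = t * B α f₁
      w⊥ = Perp-∙ t (proj-perp α)
      scaled : α ∼ hyp a 1# w
      scaled = B α e₁ , (t , bt) , λ i → combine₁ _ bt
        (solve 6 (λ v a b t e f → v := b :* (t :* (v :+ :- a :* e :+ :- b :* f) :+ (t :* a) :* e :+ :1 :* f)
            :+ (:- (v :- b :* f)) :* (b :* t :- :1)) refl _ _ _ _ _ _)
      norm : (a * 1# + a * 1#) + B w w ≈ 0#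
      norm = trans (sym (hyp-norm w⊥ a 1#)) (↝-B (∼⇒↝ scaled) αα)
      coefficient : a + (B w w - h * B w w * 1#) ≈ 0#
      coefficient = combine₂ _ _ norm h+h≈1 (solve 3 (λ h a q → a :+ (q :- h :* q :* :1)
          := :0 :+ (:1 :- h) :* ((a :* :1 :+ a :* :1) :+ q :- :0) :+ a :* (h :+ h :- :1)) refl _ _ _)

    -- Moves inside the complement of e₁ and f₁; by lift each acts on all hyp a b (t ∙ w) at once.
    record _⇝_ (w w′ : V) : Set (c ⊔ ℓ) where
      field
        isometry : Isometry
        fixes-e₁ : map isometry e₁ ≋ e₁
        fixes-f₁ : map isometry f₁ ≋ f₁
        reaches : w ≋ map isometry w′

    ≋⇒⇝ : ∀ {w w′} → w ≋ w′ → w ⇝ w′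
    ≋⇒⇝ p = record { isometry = id-isometry ; fixes-e₁ = λ _ → refl ; fixes-f₁ = λ _ → refl ; reaches = p }

    ⇝-trans : ∀ {u v w} → u ⇝ v → v ⇝ w → u ⇝ w
    ⇝-trans p q = record
      { isometry = P.isometry ⊚ Q.isometry
      ; fixes-e₁ = ≋-trans (map-cong P.isometry Q.fixes-e₁) P.fixes-e₁
      ; fixes-f₁ = ≋-trans (map-cong P.isometry Q.fixes-f₁) P.fixes-f₁
      ; reaches = ≋-trans P.reaches (map-cong P.isometry Q.reaches) }
      where
      module P = _⇝_ p
      module Q = _⇝_ q

    ⇝-perp : ∀ {w w′} → w ⇝ w′ → Perp w → Perp w′
    ⇝-perp {w} {w′} p (q , r) =
      trans (sym (map-B P.isometry w′ e₁)) (trans (B-cong (≋-sym P.reaches) P.fixes-e₁) q) ,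
      trans (sym (map-B P.isometry w′ f₁)) (trans (B-cong (≋-sym P.reaches) P.fixes-f₁) r)
      where module P = _⇝_ p

    lift : ∀ {w w′} a b t → w ⇝ w′ → hyp a b (t ∙ w) ↝ hyp a b (t ∙ w′)
    lift {w} {w′} a b t p = record
      { isometry = P.isometry
      ; fixes = ≋⇒∼ P.fixes-e₁
      ; reaches = ≋⇒∼ (≋-sym (≋-trans (map-lc P.isometry (t ∙ w′) a e₁ b f₁)
          (λ i → +-cong (+-cong (trans (map-∙ P.isometry t w′ i) (*-congˡ (sym (P.reaches i))))
                                (*-congˡ (P.fixes-e₁ i))) (*-congˡ (P.fixes-f₁ i))))) }
      where module P = _⇝_ p

    -- Simplification applies `Φ` to w, but the isometry must lead back to w. It is therefore the
    -- transposed `Φ`, which has to be an isometry in its own right: hence two `Adjoint` arguments.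
    ⇝-Φ : ∀ {x y a₁ a₂ b₁ b₂} → Adjoint x y a₁ a₂ b₁ b₂ → Adjoint x y a₁ b₁ a₂ b₂ →
          Perp x → Perp y → ∀ w → w ⇝ Φ x y a₁ a₂ b₁ b₂ w
    ⇝-Φ {x} {y} adj adjᵗ (xe , xf) (ye , yf) w = record
      { isometry = Φ-isometry adjᵗ
      ; fixes-e₁ = Φ-fixes adjᵗ (trans (B-sym e₁ x) xe) (trans (B-sym e₁ y) ye)
      ; fixes-f₁ = Φ-fixes adjᵗ (trans (B-sym f₁ x) xf) (trans (B-sym f₁ y) yf)
      ; reaches = ≋-sym (Φ-inverse adj w) }

    ⇝-reflect : ∀ {x q} → B x x * q ≈ 1# → Perp x → ∀ w → w ⇝ (w ⊕ (- (q + q) * B w x) ∙ x)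
    ⇝-reflect {x} {q} xxq x⊥ w = ⇝-trans (⇝-Φ (reflection xxq) (reflection xxq) x⊥ x⊥ w)
      (≋⇒⇝ (λ i → solve 4 (λ k w x b → w :+ (k :* b :+ :0 :* b) :* x :+ (:0 :* b :+ :0 :* b) :* x
          := w :+ k :* b :* x) refl _ _ _ _))

-- A missed value `j` could be punched out of the codomain, leaving an injection of n + 1 elements
-- into n.
injective⇒surjective : ∀ {n} {f : Fin n → Fin n} → Injective _≡_ _≡_ f → ∀ j → ∃ λ i → f i ≡ j
injective⇒surjective {suc n} {f} inj j with FinP.any? (λ i → f i FinP.≟ j)
... | yes hit = hit
... | no miss = ⊥-elim (ℕP.1+n≰n (FinP.injective⇒≤ {f = λ i → punchOut (avoid i)}
    (λ eq → inj (FinP.punchOut-injective (avoid _) (avoid _) eq))))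
  where
  avoid : ∀ i → ¬ (j ≡ f i)
  avoid i eq = miss (i , ≡.sym eq)

-- Arithmetic of the Galois ring: locality, squares, powers of p.

module GaloisRing {c ℓ} (R : CommutativeRing c ℓ) (p s m : ℕ) (p-prime : Prime p)
                  (galois : Orth.IsGaloisRing R p s m)
                  (h : CommutativeRing.Carrier R)
                  (h+h≈1 : Basics.IsHalf R h) where
  open CommutativeRing R hiding (zero)
  open Orth R
  open IntegerSolver R
  open Basics R

  private
    N = p ^ (s ℕ.* m)
    enum = proj₁ (proj₁ (proj₂ galois))
    enum-injective = proj₁ (proj₂ (proj₁ (proj₂ galois)))

  index : Carrier → Fin N
  index x = proj₁ (proj₂ (proj₂ (proj₁ (proj₂ galois))) x)

  enum-index : ∀ x → enum (index x) ≈ x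
  enum-index x = proj₂ (proj₂ (proj₂ (proj₁ (proj₂ galois))) x)

  index-injective : ∀ {x y} → index x ≡ index y → x ≈ y
  index-injective {x} {y} eq = trans (sym (enum-index x)) (trans (reflexive (≡.cong enum eq)) (enum-index y))

  index-cong : ∀ {x y} → x ≈ y → index x ≡ index y
  index-cong {x} {y} eq = enum-injective _ _ (trans (enum-index x) (trans eq (sym (enum-index y))))

  infix 4 _≈?_
  -- Opaque, so that type checking does not unfold the searches through all of R.
  abstract
    _≈?_ : ∀ x y → Dec (x ≈ y)
    x ≈? y = map′ index-injective index-cong (index x FinP.≟ index y)

    unit? : ∀ x → Dec (IsUnit x)
    unit? x = map′ (λ (i , eq) → enum i , eq) (λ (y , eq) → index y , trans (*-congˡ (enum-index y)) eq)
      (FinP.any? (λ i → x * enum i ≈? 1#))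

  injective-endo⇒surjective : (f : Carrier → Carrier) → (∀ {x y} → x ≈ y → f x ≈ f y) →
    (∀ x y → f x ≈ f y → x ≈ y) → ∀ y → ∃ λ x → f x ≈ y
  injective-endo⇒surjective f f-cong f-inj y =
    let (i , eq) = injective⇒surjective {f = λ i → index (f (enum i))}
                     (λ eq → enum-injective _ _ (f-inj _ _ (index-injective eq))) (index y)
    in enum i , index-injective eq

  unit-cong : ∀ {x y} → x ≈ y → IsUnit x → IsUnit y
  unit-cong eq (x′ , p) = x′ , trans (*-congʳ (sym eq)) p

  unit-*ˡ : ∀ {x y} → IsUnit (x * y) → IsUnit x
  unit-*ˡ {x} {y} (t , p) = y * t , trans (sym (*-assoc x y t)) p

  unit-*ʳ : ∀ {x y} → IsUnit (x * y) → IsUnit y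
  unit-*ʳ u = unit-*ˡ (unit-cong (*-comm _ _) u)

  unit-neg : ∀ {x} → IsUnit x → IsUnit (- x)
  unit-neg {x} (t , p) = - t , trans (solve 2 (λ x t → :- x :* :- t := x :* t) refl x t) p

  unit-cancelˡ : ∀ {u x} → IsUnit u → u * x ≈ 0# → x ≈ 0#
  unit-cancelˡ {u} {x} (t , p) eq = combine₂ _ _ p eq (solve 3 (λ u t x → x
      := :0 :+ (:- x) :* (u :* t :- :1) :+ t :* (u :* x :- :0)) refl u t x)

  nonunit⇒p∣ : ∀ {x} → ¬ IsUnit x → ∃ λ y → x ≈ nat p * y
  nonunit⇒p∣ {x} = proj₁ (proj₂ (proj₂ galois) x)

  p∣⇒nonunit : ∀ {x} y → x ≈ nat p * y → ¬ IsUnit x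
  p∣⇒nonunit {x} y eq = proj₂ (proj₂ (proj₂ galois) x) (y , eq)

  nonunit-0 : ¬ IsUnit 0#
  nonunit-0 = p∣⇒nonunit 0# (sym (zeroʳ _))

  -- Locality of R: the nonunits are exactly the multiples of p.
  nonunit-+ : ∀ {x y} → ¬ IsUnit x → ¬ IsUnit y → ¬ IsUnit (x + y)
  nonunit-+ nx ny with nonunit⇒p∣ nx | nonunit⇒p∣ ny
  ... | x′ , p | y′ , q = p∣⇒nonunit (x′ + y′) (trans (+-cong p q) (sym (distribˡ _ _ _)))

  nonunit-neg : ∀ {x} → ¬ IsUnit x → ¬ IsUnit (- x)
  nonunit-neg nx u = nx (unit-cong (solve 1 (λ x → :- :- x := x) refl _) (unit-neg u))

  nonunit-*ˡ : ∀ {x} y → ¬ IsUnit x → ¬ IsUnit (x * y)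
  nonunit-*ˡ y nx u = nx (unit-*ˡ u)

  nonunit-*ʳ : ∀ x {y} → ¬ IsUnit y → ¬ IsUnit (x * y)
  nonunit-*ʳ x ny u = ny (unit-*ʳ u)

  unit+nonunit : ∀ {x y} → IsUnit x → ¬ IsUnit y → IsUnit (x + y)
  unit+nonunit {x} {y} ux ny with unit? (x + y)
  ... | yes u = u
  ... | no nu = ⊥-elim (nonunit-+ nu (nonunit-neg ny) (unit-cong (solve 2 (λ x y → x
      := (x :+ y) :- y) refl x y) ux))

  unit-2 : IsUnit (1# + 1#)
  unit-2 = h , trans (solve 1 (λ h → (:1 :+ :1) :* h := h :+ h) refl h) h+h≈1

  unit-+⇒⊎ : ∀ {x y} → IsUnit (x + y) → IsUnit x ⊎ IsUnit y
  unit-+⇒⊎ {x} {y} u with unit? x | unit? y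
  ... | yes ux | _ = inj₁ ux
  ... | no _ | yes uy = inj₂ uy
  ... | no nx | no ny = ⊥-elim (nonunit-+ nx ny u)

  unit-double : ∀ {x} → IsUnit x → IsUnit (x + x)
  unit-double {x} ux = unit-cong (solve 1 (λ x → (:1 :+ :1) :* x := x :+ x) refl x) (unit-* unit-2 ux)

  -- One of x − y and x + y is a unit, since their sum 2x is.
  square-injective : ∀ {x y} → IsUnit x → x * x ≈ y * y → x ≈ y ⊎ x ≈ - y
  square-injective {x} {y} ux eq = [ (λ u → inj₂ (combine₁ 1# (unit-cancelˡ u (combine₁ 1# eq
          (solve 2 (λ x y → (x :- y) :* (x :+ y) := :0 :+ :1 :* (x :* x :- y :* y)) refl x y)))
          (solve 2 (λ x y → x := :- y :+ :1 :* (x :+ y :- :0)) refl x y)))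
    , (λ u → inj₁ (combine₁ 1# (unit-cancelˡ u (combine₁ 1# eq
          (solve 2 (λ x y → (x :+ y) :* (x :- y) := :0 :+ :1 :* (x :* x :- y :* y)) refl x y)))
          (solve 2 (λ x y → x := y :+ :1 :* (x :- y :- :0)) refl x y)))
    ]′ (unit-+⇒⊎ {x - y} {x + y} (unit-cong (solve 2 (λ x y → x :+ x := (x :- y) :+ (x :+ y)) refl x y)
        (unit-double ux)))

  unit⇒≉neg : ∀ {x} → IsUnit x → ¬ (x ≈ - x)
  unit⇒≉neg {x} ux eq = nonunit-0 (unit-cong (combine₁ 1# eq (solve 1 (λ x → x :+ x
      := :0 :+ :1 :* (x :- :- x)) refl x)) (unit-double ux))

  -- Squaring maps 1 + pR injectively, hence surjectively, to itself.
  1+nonunit-square : ∀ {x} → ¬ IsUnit x → ∃ λ w → w * w ≈ 1# + x × IsUnit (1# + w)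
  1+nonunit-square {x} nx = result
    where
    f : Carrier → Carrier
    -- Extended by the identity off 1 + pR, because the surjectivity argument concerns self-maps of
    -- all of R.
    f y with unit? (y - 1#)
    ... | yes _ = y
    ... | no _ = y * y

    square-nonunit : ∀ {y} → ¬ IsUnit (y - 1#) → ¬ IsUnit (y * y - 1#)
    square-nonunit {y} ny u = nonunit-*ˡ (y + 1#) ny (unit-cong (solve 1 (λ y → y :* y :- :1
        := (y :- :1) :* (y :+ :1)) refl y) u)

    unit-near-1 : ∀ {y} → ¬ IsUnit (y - 1#) → IsUnit y
    unit-near-1 {y} ny = unit-cong (solve 1 (λ y → :1 :+ (y :- :1) := y) refl y) (unit+nonunit unit-1 ny)

    f-cong : ∀ {x y} → x ≈ y → f x ≈ f y
    f-cong {x} {y} eq with unit? (x - 1#) | unit? (y - 1#)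
    ... | yes _ | yes _ = eq
    ... | yes u | no nu = ⊥-elim (nu (unit-cong (+-congʳ eq) u))
    ... | no nu | yes u = ⊥-elim (nu (unit-cong (+-congʳ (sym eq)) u))
    ... | no _ | no _ = *-cong eq eq

    f-injective : ∀ x y → f x ≈ f y → x ≈ y
    f-injective x y eq with unit? (x - 1#) | unit? (y - 1#)
    ... | yes _ | yes _ = eq
    ... | yes u | no nu = ⊥-elim (square-nonunit nu (unit-cong (+-congʳ eq) u))
    ... | no nu | yes u = ⊥-elim (square-nonunit nu (unit-cong (+-congʳ (sym eq)) u))
    ... | no nx | no ny = [ (λ x≈y → x≈y)
        -- Both x and y = -x would lie in 1 + pR, making (x - 1) + (y - 1) = -2 a nonunit.
        , (λ x≈-y → ⊥-elim (nonunit-+ nx ny (unit-cong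
              (combine₁ (- 1#) x≈-y (solve 2 (λ x y → :- (:1 :+ :1)
                  := (x :- :1) :+ (y :- :1) :+ (:- :1) :* (x :- :- y)) refl x y))
              (unit-neg unit-2))))
        ]′ (square-injective (unit-near-1 nx) eq)

    result : ∃ λ w → w * w ≈ 1# + x × IsUnit (1# + w)
    result = finish (injective-endo⇒surjective f f-cong f-injective (1# + x))
      where
      finish : (∃ λ w → f w ≈ 1# + x) → ∃ λ w → w * w ≈ 1# + x × IsUnit (1# + w)
      finish (w , eq) with unit? (w - 1#)
      ... | yes u = ⊥-elim (nx (unit-cong (combine₁ 1# eq (solve 2 (λ w x → w :- :1
          := x :+ :1 :* (w :- (:1 :+ x))) refl w x)) u))
      -- Since w ≡ 1 modulo p, 1 + w ≡ 2. This singles out one of the roots ±w, the one for which a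
      -- later reflecting vector has unit norm.
      ... | no nu = w , eq , unit-cong (solve 1 (λ w → (:1 :+ :1) :+ (w :- :1) := :1 :+ w) refl w)
          (unit+nonunit unit-2 nu)

  nonSquare-proportional : ∀ {z x y} → IsNonSquareUnit z → IsUnit y → ¬ (x * x ≈ z * (y * y))
  nonSquare-proportional {z} {x} {y} (_ , nsq) (t , yt) eq = nsq (x * t) (combine₂ (t * t) (z * (y * t + 1#))
      eq yt
    (solve 4 (λ x y z t → x :* t :* (x :* t)
        := z :+ (t :* t) :* (x :* x :- z :* (y :* y)) :+ (z :* (y :* t :+ :1)) :* (y :* t :- :1)) refl x y z
        t))

  -- Pick one unit out of each pair {x , −x}; sending the picked x to x² and the others
  -- to z x² is injective, hence surjective.
  unit-square-class : ∀ {z} → IsNonSquareUnit z → ∀ {u} → IsUnit u →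
    ∃ λ a → ∃ λ x → (a ≈ 1# ⊎ a ≈ z) × IsUnit x × u ≈ a * (x * x)
  unit-square-class {z} nsq {u} uu = result
    where
    -- Positions in the enumeration of R serve as an order that tells x from -x.
    Picked : Carrier → Set
    Picked x = toℕ (index x) < toℕ (index (- x))

    picked? : ∀ x → Dec (Picked x)
    picked? x = toℕ (index x) ℕ.<? toℕ (index (- x))

    module _ {x y : Carrier} (x≈-y : x ≈ - y) where
      -x≈y : - x ≈ y
      -x≈y = trans (-‿cong x≈-y) (solve 1 (λ y → :- :- y := y) refl y)

      picked-neg : Picked x → ¬ Picked y
      picked-neg px py = ℕP.<-asym
        (≡.subst (λ j → toℕ (index x) < toℕ j) (index-cong -x≈y) px)
        (≡.subst (λ j → toℕ (index y) < toℕ j) (index-cong (sym x≈-y)) py)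

      unpicked-neg : IsUnit x → ¬ Picked x → Picked y
      unpicked-neg ux npx with ℕP.<-cmp (toℕ (index x)) (toℕ (index (- x)))
      ... | tri< px _ _ = ⊥-elim (npx px)
      ... | tri≈ _ eq _ = ⊥-elim (unit⇒≉neg ux (index-injective (FinP.toℕ-injective eq)))
      ... | tri> _ _ py = ≡.subst₂ (λ j k → toℕ j < toℕ k) (index-cong -x≈y) (index-cong x≈-y) py

    picked-cong : ∀ {x y} → x ≈ y → Picked x → Picked y
    picked-cong eq = ≡.subst₂ (λ j k → toℕ j < toℕ k) (index-cong eq) (index-cong (-‿cong eq))

    g : Carrier → Carrier
    g x with unit? x | picked? x
    ... | no _ | _ = x
    ... | yes _ | yes _ = x * x
    ... | yes _ | no _ = z * (x * x)

    unit-zx² : ∀ {x} → IsUnit x → IsUnit (z * (x * x))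
    unit-zx² ux = unit-* (proj₁ nsq) (unit-* ux ux)

    g-cong : ∀ {x y} → x ≈ y → g x ≈ g y
    g-cong {x} {y} eq with unit? x | unit? y | picked? x | picked? y
    ... | no _ | no _ | _ | _ = eq
    ... | no nx | yes uy | _ | _ = ⊥-elim (nx (unit-cong (sym eq) uy))
    ... | yes ux | no ny | _ | _ = ⊥-elim (ny (unit-cong eq ux))
    ... | yes _ | yes _ | yes _ | yes _ = *-cong eq eq
    ... | yes _ | yes _ | no _ | no _ = *-congˡ (*-cong eq eq)
    ... | yes _ | yes _ | yes px | no npy = ⊥-elim (npy (picked-cong eq px))
    ... | yes _ | yes _ | no npx | yes py = ⊥-elim (npx (picked-cong (sym eq) py))

    z-cancel : ∀ {x y} → z * x ≈ z * y → x ≈ y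
    z-cancel {x} {y} eq = combine₁ 1# (unit-cancelˡ (proj₁ nsq) (combine₁ 1# eq
      (solve 3 (λ x y z → z :* (x :- y) := :0 :+ :1 :* (z :* x :- z :* y)) refl x y z)))
      (solve 2 (λ x y → x := y :+ :1 :* (x :- y :- :0)) refl x y)

    g-injective : ∀ x y → g x ≈ g y → x ≈ y
    g-injective x y eq with unit? x | unit? y | picked? x | picked? y
    ... | no _ | no _ | _ | _ = eq
    ... | no nx | yes uy | _ | yes _ = ⊥-elim (nx (unit-cong (sym eq) (unit-* uy uy)))
    ... | no nx | yes uy | _ | no _ = ⊥-elim (nx (unit-cong (sym eq) (unit-zx² uy)))
    ... | yes ux | no ny | yes _ | _ = ⊥-elim (ny (unit-cong eq (unit-* ux ux)))
    ... | yes ux | no ny | no _ | _ = ⊥-elim (ny (unit-cong eq (unit-zx² ux)))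
    -- The values x² and z y² never meet, since z is not a square.
    ... | yes ux | yes uy | yes _ | no _ = ⊥-elim (nonSquare-proportional nsq uy eq)
    ... | yes ux | yes uy | no _ | yes _ = ⊥-elim (nonSquare-proportional nsq ux (sym eq))
    ... | yes ux | yes uy | yes px | yes py =
      [ (λ x≈y → x≈y) , (λ x≈-y → ⊥-elim (picked-neg x≈-y px py)) ]′ (square-injective ux eq)
    ... | yes ux | yes uy | no npx | no npy =
      [ (λ x≈y → x≈y) , (λ x≈-y → ⊥-elim (npy (unpicked-neg x≈-y ux npx))) ]′
          (square-injective ux (z-cancel eq))

    result : ∃ λ a → ∃ λ x → (a ≈ 1# ⊎ a ≈ z) × IsUnit x × u ≈ a * (x * x)
    result = finish (injective-endo⇒surjective g g-cong g-injective u)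
      where
      finish : (∃ λ x → g x ≈ u) → ∃ λ a → ∃ λ x → (a ≈ 1# ⊎ a ≈ z) × IsUnit x × u ≈ a * (x * x)
      finish (x , eq) with unit? x | picked? x
      ... | no nx | _ = ⊥-elim (nx (unit-cong (sym eq) uu))
      ... | yes ux | yes _ = 1# , x , inj₁ refl , ux , trans (sym eq) (sym (*-identityˡ _))
      ... | yes ux | no _ = z , x , inj₂ refl , ux , sym eq

  -- If f were a unit, N = c² - z f² being a nonunit would make c² a unit, and z f² = c² (1 - N /
  -- c²) would be a square because 1 - N / c² is one. So f is a nonunit, and then a unit c would
  -- make N a unit.
  anisotropic : ∀ {z c f} → IsNonSquareUnit z → ¬ IsUnit (c * c - z * (f * f)) → ¬ IsUnit c × ¬ IsUnit f
  anisotropic {z} {c} {f} nsq nu = nc , nf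
    where
    nf : ¬ IsUnit f
    nf uf = nonSquare-proportional nsq uf (sym zff)
      where
      ucc : IsUnit (c * c)
      ucc = unit-cong (solve 3 (λ z c f → z :* (f :* f) :+ (c :* c :- z :* (f :* f)) := c :* c) refl z c f)
              (unit+nonunit (unit-* (proj₁ nsq) (unit-* uf uf)) nu)
      t = proj₁ ucc
      root = 1+nonunit-square (nonunit-neg (nonunit-*ˡ t nu))
      zff : z * (f * f) ≈ (c * proj₁ root) * (c * proj₁ root)
      zff = combine₂ _ _ (proj₂ ucc) (proj₁ (proj₂ root))
        (solve 5 (λ z c f t w → z :* (f :* f)
            := (c :* w) :* (c :* w) :+ (c :* c :- z :* (f :* f)) :* (c :* c :* t :- :1)
            :+ (:- (c :* c)) :* (w :* w :- (:1 :+ :- ((c :* c :- z :* (f :* f)) :* t)))) refl z c f t _)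
    nc : ¬ IsUnit c
    nc uc = nu (unit+nonunit (unit-* uc uc) (nonunit-neg (nonunit-*ʳ z (nonunit-*ˡ f nf))))

  nat-+ : ∀ a b → nat (a ℕ.+ b) ≈ nat a + nat b
  nat-+ zero b = sym (+-identityˡ _)
  nat-+ (suc a) b = trans (+-congˡ (nat-+ a b)) (sym (+-assoc _ _ _))

  nat-* : ∀ a b → nat (a ℕ.* b) ≈ nat a * nat b
  nat-* zero b = sym (zeroˡ _)
  nat-* (suc a) b = trans (nat-+ b (a ℕ.* b)) (trans (+-congˡ (nat-* a b))
    (solve 2 (λ a b → b :+ a :* b := (:1 :+ a) :* b) refl _ _))

  pw-+ : ∀ r t → pw p (r ℕ.+ t) ≈ pw p r * pw p t
  pw-+ r t = trans (reflexive (≡.cong nat (ℕP.^-distribˡ-+-* p r t))) (nat-* (p ^ r) (p ^ t))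

  pw-2* : ∀ r → pw p (2 ℕ.* r) ≈ pw p r * pw p r
  pw-2* r = trans (reflexive (≡.cong (pw p) (≡.cong (r ℕ.+_) (ℕP.+-identityʳ r)))) (pw-+ r r)

  pw-0 : pw p 0 ≈ 1#
  pw-0 = +-identityʳ 1#

  pw-nonzero : ∀ {r} → r < s → ¬ (pw p r ≈ 0#)
  pw-nonzero {r} r<s = proj₂ (proj₁ galois) (p ^ r) (ℕP.m^n>0 p r) (ℕP.^-monoʳ-< p 1<p r<s)
    where
    instance
      p-nonTrivial = prime⇒nonTrivial p-prime
      p-nonZero = ℕ.nonTrivial⇒nonZero p
    1<p = ℕ.nonTrivial⇒n>1 p

  pw-vanishes : ∀ {r} → s ≤ r → pw p r ≈ 0#
  pw-vanishes {r} s≤r = trans (reflexive (≡.cong (pw p) (≡.sym (ℕP.m+[n∸m]≡n s≤r))))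
    (trans (pw-+ s (r ℕ.∸ s)) (trans (*-congʳ (proj₁ (proj₁ galois))) (zeroˡ _)))

  record Primitive-part {n} (w : Vector n) : Set (c ⊔ ℓ) where
    field
      r : ℕ
      r<s : r < s
      part : Vector n
      factors : w ≋ (λ i → pw p r * part i)
      position : Fin n
      unit : IsUnit (part position)

    positive : (∀ i → ¬ IsUnit (w i)) → 0 < r
    positive nonunit with r in eq
    ... | suc _ = ℕ.s≤s ℕ.z≤n
    ... | zero = ⊥-elim (nonunit position (unit-cong (sym (trans (factors position)
           (trans (*-congʳ (trans (reflexive (≡.cong (pw p) eq)) pw-0)) (*-identityˡ _)))) unit))

  -- Factors p are split off until some entry is a unit. If this fails s times, the vector is a
  -- multiple of pˢ = 0; `fuel` counts the attempts left.
  primitive-part : ∀ {n} (w : Vector n) → (∀ i → w i ≈ 0#) ⊎ Primitive-part w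
  primitive-part {n} w = go s 0 (ℕP.+-identityʳ s) w (λ i → sym (trans (*-congʳ pw-0) (*-identityˡ _)))
    where
    go : ∀ fuel r → fuel ℕ.+ r ≡ s → (v : Vector n) → w ≋ (λ i → pw p r * v i) → (∀ i → w i ≈ 0#) ⊎
        Primitive-part w
    go zero r eq v w≋ = inj₁ (λ i → trans (w≋ i) (trans (*-congʳ (pw-vanishes (ℕP.≤-reflexive (≡.sym eq))))
        (zeroˡ _)))
    go (suc fuel) r eq v w≋ with FinP.any? (λ i → unit? (v i))
    ... | yes (i , u) = inj₂ (record { r = r ; r<s = ≡.subst (r <_) eq (ℕ.s≤s (ℕP.m≤n+m r fuel))
                                      ; part = v ; factors = w≋ ; position = i ; unit = u })
    ... | no none = go fuel (suc r) (≡.trans (ℕP.+-suc fuel r) eq) (λ i → proj₁ (quotient i)) (λ i →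
        trans (w≋ i) (trans (*-congˡ (proj₂ (quotient i))) (trans (solve 3 (λ a b c → a :* (b :* c)
            := (b :* a) :* c) refl _ _ _)
          (*-congʳ (sym (nat-* p (p ^ r)))))))
      where
      quotient : ∀ i → ∃ λ y → v i ≈ nat p * y
      quotient i = nonunit⇒p∣ (λ u → none (i , u))

  valuation : ∀ x → x ≈ 0# ⊎ (∃ λ r → ∃ λ u → r < s × IsUnit u × x ≈ pw p r * u)
  valuation x with primitive-part {1} (λ _ → x)
  ... | inj₁ zeros = inj₁ (zeros Fin.zero)
  ... | inj₂ part = inj₂ (P.r , P.part P.position , P.r<s , P.unit , P.factors P.position)
    where module P = Primitive-part part

-- The matrix `S`: symmetry, and the coordinates its rows read off.

module Coordinates {c ℓ} (R : CommutativeRing c ℓ) (ν δ : ℕ) (d z : CommutativeRing.Carrier R) where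
  open CommutativeRing R hiding (zero)
  open Orth R
  open IntegerSolver R
  open Basics R
  open Graph ν δ d z

  indicator : ℕ → ℕ → Carrier
  indicator a b = if does (a ℕ.≟ b) then 1# else 0#

  indicator-≡ : ∀ {a b} → a ≡ b → indicator a b ≈ 1#
  indicator-≡ {a} {b} eq = reflexive (≡.cong (if_then 1# else 0#) (dec-true (a ℕ.≟ b) eq))

  indicator-≢ : ∀ {a b} → ¬ (a ≡ b) → indicator a b ≈ 0#
  indicator-≢ {a} {b} neq = reflexive (≡.cong (if_then 1# else 0#) (dec-false (a ℕ.≟ b) neq))

  indicator-⇔ : ∀ {a b a′ b′} → (a ≡ b → a′ ≡ b′) → (a′ ≡ b′ → a ≡ b) → indicator a b ≈ indicator a′ b′
  indicator-⇔ {a} {b} to from = decide (a ℕ.≟ b)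
    where
    decide : Dec (a ≡ b) → _
    decide (yes eq) = trans (indicator-≡ eq) (sym (indicator-≡ (to eq)))
    decide (no neq) = trans (indicator-≢ neq) (sym (indicator-≢ (λ eq → neq (from eq))))

  2ν≡ν+ν : 2 ℕ.* ν ≡ ν ℕ.+ ν
  2ν≡ν+ν = ≡.cong (ν ℕ.+_) (ℕP.+-identityʳ ν)

  Upper Middle Lower : ℕ → Set
  Upper a = a < ν
  Middle a = ν ≤ a × a < 2 ℕ.* ν
  Lower a = 2 ℕ.* ν ≤ a

  data Region (a : ℕ) : Set where
    upper : Upper a → Region a
    middle : Middle a → Region a
    lower : Lower a → Region a

  region : ∀ a → Region a
  region a with a ℕ.<? ν | a ℕ.<? 2 ℕ.* ν
  ... | yes p | _ = upper p
  ... | no p | yes q = middle (ℕP.≮⇒≥ p , q)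
  ... | no _ | no q = lower (ℕP.≮⇒≥ q)

  ν≤2ν : ν ≤ 2 ℕ.* ν
  ν≤2ν = ℕP.m≤m+n ν _

  private
    -- `Smat` with its seven Boolean tests turned into arguments: tests settled by the region of the
    -- row are replaced by congruence, while the others stay symbolic.
    entry : Bool → Bool → Bool → Bool → Bool → Bool → Bool → ℕ → Carrier
    entry b₁ b₂ b₃ b₄ b₅ b₆ b₇ a =
      if b₁ ∧ b₂ then 1# else if b₃ ∧ b₄ ∧ b₅ then 1# else if b₆ ∧ b₇ then Δe δ d z (a ℕ.∸ 2 ℕ.* ν) else 0#

  S-upper : ∀ i j → Upper (toℕ i) → S i j ≈ indicator (toℕ j) (toℕ i ℕ.+ ν)
  S-upper i j a<ν = reflexive (≡.trans
    (≡.cong₂ (λ b b′ → entry b (does (toℕ j ℕ.≟ a ℕ.+ ν)) b′ (does (a ℕ.<? 2 ℕ.* ν))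
        (does (a ℕ.≟ toℕ j ℕ.+ ν)) (does (2 ℕ.* ν ℕ.≤? a)) (does (a ℕ.≟ toℕ j)) a)
      (dec-true (a ℕ.<? ν) a<ν) (dec-false (ν ℕ.≤? a) (ℕP.<⇒≱ a<ν)))
    (≡.cong (λ b → entry true (does (toℕ j ℕ.≟ a ℕ.+ ν)) false (does (a ℕ.<? 2 ℕ.* ν))
        (does (a ℕ.≟ toℕ j ℕ.+ ν)) b (does (a ℕ.≟ toℕ j)) a)
      (dec-false (2 ℕ.* ν ℕ.≤? a) (ℕP.<⇒≱ (ℕP.<-≤-trans a<ν ν≤2ν)))))
    where a = toℕ i

  S-middle : ∀ i j → Middle (toℕ i) → S i j ≈ indicator (toℕ i) (toℕ j ℕ.+ ν)
  S-middle i j (ν≤a , a<2ν) = reflexive (≡.trans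
    (≡.cong₂ (λ b b′ → entry b (does (toℕ j ℕ.≟ a ℕ.+ ν)) b′ (does (a ℕ.<? 2 ℕ.* ν))
        (does (a ℕ.≟ toℕ j ℕ.+ ν)) (does (2 ℕ.* ν ℕ.≤? a)) (does (a ℕ.≟ toℕ j)) a)
      (dec-false (a ℕ.<? ν) (ℕP.≤⇒≯ ν≤a)) (dec-true (ν ℕ.≤? a) ν≤a))
    (≡.cong₂ (λ b b′ → entry false (does (toℕ j ℕ.≟ a ℕ.+ ν)) true b (does (a ℕ.≟ toℕ j ℕ.+ ν)) b′
        (does (a ℕ.≟ toℕ j)) a)
      (dec-true (a ℕ.<? 2 ℕ.* ν) a<2ν) (dec-false (2 ℕ.* ν ℕ.≤? a) (ℕP.<⇒≱ a<2ν))))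
    where a = toℕ i

  S-lower : ∀ i j → Lower (toℕ i) → S i j ≈ Δe δ d z (toℕ i ℕ.∸ 2 ℕ.* ν) * indicator (toℕ i) (toℕ j)
  S-lower i j 2ν≤a = trans (reflexive (≡.trans
    (≡.cong₂ (λ b b′ → entry b (does (toℕ j ℕ.≟ a ℕ.+ ν)) (does (ν ℕ.≤? a)) b′ (does (a ℕ.≟ toℕ j ℕ.+ ν))
        (does (2 ℕ.* ν ℕ.≤? a)) (does (a ℕ.≟ toℕ j)) a)
      (dec-false (a ℕ.<? ν) (ℕP.≤⇒≯ (ℕP.≤-trans ν≤2ν 2ν≤a))) (dec-false (a ℕ.<? 2 ℕ.* ν) (ℕP.≤⇒≯ 2ν≤a)))
    (≡.cong₂ (λ b b′ → entry false (does (toℕ j ℕ.≟ a ℕ.+ ν)) b false (does (a ℕ.≟ toℕ j ℕ.+ ν)) b′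
        (does (a ℕ.≟ toℕ j)) a)
      (dec-true (ν ℕ.≤? a) (ℕP.≤-trans ν≤2ν 2ν≤a)) (dec-true (2 ℕ.* ν ℕ.≤? a) 2ν≤a))))
          (selected (does (a ℕ.≟ toℕ j)))
    where
    a = toℕ i
    selected : ∀ b → (if b then Δe δ d z (a ℕ.∸ 2 ℕ.* ν) else 0#) ≈ Δe δ d z (a ℕ.∸ 2 ℕ.* ν) *
        (if b then 1# else 0#)
    selected true = sym (*-identityʳ _)
    selected false = sym (zeroʳ _)

  middle≢+ν : ∀ {a b} → a < 2 ℕ.* ν → ν ≤ b → ¬ (a ≡ b ℕ.+ ν)
  middle≢+ν a<2ν ν≤b eq = ℕP.<⇒≱ a<2ν (ℕP.≤-trans (ℕP.≤-trans (ℕP.≤-reflexive 2ν≡ν+ν) (ℕP.+-monoˡ-≤ ν ν≤b))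
      (ℕP.≤-reflexive (≡.sym eq)))

  upper≢+ν : ∀ {a} b → a < ν → ¬ (a ≡ b ℕ.+ ν)
  upper≢+ν b a<ν eq = ℕP.<⇒≱ a<ν (ℕP.≤-trans (ℕP.m≤n+m ν b) (ℕP.≤-reflexive (≡.sym eq)))

  lower≢+ν : ∀ {a b} → 2 ℕ.* ν ≤ a → b < ν → ¬ (a ≡ b ℕ.+ ν)
  lower≢+ν 2ν≤a b<ν eq = ℕP.<⇒≱ (ℕP.+-monoˡ-< ν b<ν) (ℕP.≤-trans (ℕP.≤-reflexive (≡.sym 2ν≡ν+ν))
      (ℕP.≤-trans 2ν≤a (ℕP.≤-reflexive eq)))

  S-upper-lower : ∀ i j → Upper (toℕ i) → Lower (toℕ j) → S i j ≈ S j i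
  S-upper-lower i j p q = trans (trans (S-upper i j p) (indicator-≢ (lower≢+ν q p)))
    (sym (trans (S-lower j i q)
        (trans (*-congˡ (indicator-≢ (λ eq → ℕP.<⇒≱ p (ℕP.≤-trans ν≤2ν (ℕP.≤-trans q (ℕP.≤-reflexive eq))))))
        (zeroʳ _))))

  S-middle-lower : ∀ i j → Middle (toℕ i) → Lower (toℕ j) → S i j ≈ S j i
  S-middle-lower i j p q = trans
      (trans (S-middle i j p) (indicator-≢ (middle≢+ν (proj₂ p) (ℕP.≤-trans ν≤2ν q))))
    (sym (trans (S-lower j i q)
        (trans (*-congˡ (indicator-≢ (λ eq → ℕP.<⇒≱ (proj₂ p) (ℕP.≤-trans q (ℕP.≤-reflexive eq)))))
        (zeroʳ _))))

  S-lower-lower : ∀ i j → Lower (toℕ i) → Lower (toℕ j) → S i j ≈ S j i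
  S-lower-lower i j p q = trans (S-lower i j p) (trans (decide (toℕ i ℕ.≟ toℕ j)) (sym (S-lower j i q)))
    where
    decide : Dec (toℕ i ≡ toℕ j) → Δe δ d z (toℕ i ℕ.∸ 2 ℕ.* ν) * indicator (toℕ i) (toℕ j)
                                 ≈ Δe δ d z (toℕ j ℕ.∸ 2 ℕ.* ν) * indicator (toℕ j) (toℕ i)
    decide (yes eq) = reflexive (≡.cong₂ (λ a b → Δe δ d z (a ℕ.∸ 2 ℕ.* ν) * indicator a b) eq (≡.sym eq))
    decide (no neq) = trans (trans (*-congˡ (indicator-≢ neq)) (zeroʳ _))
      (sym (trans (*-congˡ (indicator-≢ (λ eq → neq (≡.sym eq)))) (zeroʳ _)))

  S-sym : ∀ i j → S i j ≈ S j i
  S-sym i j = go (region (toℕ i)) (region (toℕ j))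
    where
    go : Region (toℕ i) → Region (toℕ j) → S i j ≈ S j i
    go (upper p) (upper q) = trans (trans (S-upper i j p) (indicator-≢ (upper≢+ν _ q)))
                               (sym (trans (S-upper j i q) (indicator-≢ (upper≢+ν _ p))))
    go (upper p) (middle q) = trans (S-upper i j p) (sym (S-middle j i q))
    go (upper p) (lower q) = S-upper-lower i j p q
    go (middle p) (upper q) = trans (S-middle i j p) (sym (S-upper j i q))
    go (middle p) (middle q) = trans (trans (S-middle i j p) (indicator-≢ (middle≢+ν (proj₂ p) (proj₁ q))))
                                 (sym (trans (S-middle j i q) (indicator-≢ (middle≢+ν (proj₂ q) (proj₁ p)))))
    go (middle p) (lower q) = S-middle-lower i j p q
    go (lower p) (upper q) = sym (S-upper-lower j i q p)
    go (lower p) (middle q) = sym (S-middle-lower j i q p)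
    go (lower p) (lower q) = S-lower-lower i j p q

  open Forms R S S-sym using (V; B; B-basisˡ)

  -- Each row of `S` is a multiple of a basis vector, so pairing with a basis vector reads a single
  -- coordinate.
  B-row : ∀ i k κ → (∀ j → S i j ≈ κ * basis k j) → ∀ v → B (basis i) v ≈ κ * v k
  B-row i k κ row v = trans (B-basisˡ i v) (trans
    (sum-cong n (λ j → trans (*-congʳ (row j)) (solve 3 (λ a b c → a :* b :* c := a :* (c :* b)) refl _ _ _)))
    (trans (sum-*ˡ n κ _) (*-congˡ (sum-basisʳ v k))))

  -- The hyperbolic blocks cross: coordinate k < ν is read by the basis vector ν places further on.
  B-upper : ∀ k → Upper (toℕ k) → ∀ v → B (e (suc (toℕ k ℕ.+ ν))) v ≈ v k
  B-upper k k<ν v = trans (reflexive (≡.cong (λ t → B (e (suc t)) v) (≡.sym i≡)))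
    (trans (B-row i k 1# row v) (*-identityˡ _))
    where
    k+ν<2ν : toℕ k ℕ.+ ν < 2 ℕ.* ν
    k+ν<2ν = ℕP.<-≤-trans (ℕP.+-monoˡ-< ν k<ν) (ℕP.≤-reflexive (≡.sym 2ν≡ν+ν))
    k+ν<n = ℕP.<-≤-trans k+ν<2ν (ℕP.m≤m+n (2 ℕ.* ν) δ)
    i = fromℕ< k+ν<n
    i≡ : toℕ i ≡ toℕ k ℕ.+ ν
    i≡ = FinP.toℕ-fromℕ< k+ν<n
    row : ∀ j → S i j ≈ 1# * basis k j
    row j = trans (S-middle i j (≡.subst Middle (≡.sym i≡) (ℕP.m≤n+m ν (toℕ k) , k+ν<2ν)))
      (trans (indicator-⇔ (λ eq → ≡.cong suc (ℕP.+-cancelʳ-≡ ν _ _ (≡.trans (≡.sym eq) i≡)))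
                          (λ eq → ≡.trans i≡ (≡.cong (ℕ._+ ν) (≡.sym (ℕP.suc-injective eq)))))
             (sym (*-identityˡ _)))

  B-middle : ∀ t k → t < ν → toℕ k ≡ t ℕ.+ ν → ∀ v → B (e (suc t)) v ≈ v k
  B-middle t k t<ν k≡ v = trans (reflexive (≡.cong (λ t → B (e (suc t)) v) (≡.sym i≡)))
    (trans (B-row i k 1# row v) (*-identityˡ _))
    where
    t<n = ℕP.<-≤-trans t<ν (ℕP.≤-trans ν≤2ν (ℕP.m≤m+n (2 ℕ.* ν) δ))
    i = fromℕ< t<n
    i≡ : toℕ i ≡ t
    i≡ = FinP.toℕ-fromℕ< t<n
    k≡′ = ≡.trans k≡ (≡.cong (ℕ._+ ν) (≡.sym i≡))
    row : ∀ j → S i j ≈ 1# * basis k j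
    row j = trans (S-upper i j (≡.subst Upper (≡.sym i≡) t<ν))
      (trans (indicator-⇔ {toℕ j} {toℕ i ℕ.+ ν} {suc (toℕ j)} {suc (toℕ k)}
          (λ eq → ≡.cong suc (≡.trans eq (≡.sym k≡′))) (λ eq → ≡.trans (ℕP.suc-injective eq) k≡′))
             (sym (*-identityˡ _)))

  B-lower : ∀ k → Lower (toℕ k) → ∀ v → B (basis k) v ≈ Δe δ d z (toℕ k ℕ.∸ 2 ℕ.* ν) * v k
  B-lower k 2ν≤k = B-row k k _ (λ j → trans (S-lower k j 2ν≤k)
    (*-congˡ (indicator-⇔ {toℕ k} {toℕ j} {suc (toℕ j)} {suc (toℕ k)} (λ eq → ≡.cong suc (≡.sym eq))
        (λ eq → ≡.sym (ℕP.suc-injective eq)))))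

  Δe-unit : δ ≤ 2 → IsUnit d → IsUnit (- z) → ∀ {t} → t < δ → IsUnit (Δe δ d z t)
  Δe-unit δ≤2 ud uz = go δ δ≤2 _
    where
    go : ∀ δ → δ ≤ 2 → ∀ t → t < δ → IsUnit (Δe δ d z t)
    go 1 _ 0 _ = ud
    go 2 _ 0 _ = unit-1
    go 2 _ 1 _ = uz
    go 1 _ (suc _) (ℕ.s≤s ())
    go 2 _ (suc (suc _)) (ℕ.s≤s (ℕ.s≤s ()))
    go (suc (suc (suc _))) (ℕ.s≤s (ℕ.s≤s ())) _ _

  -- Nondegeneracy of the form. The partner of k lies ν places up or down in the hyperbolic blocks,
  -- with κ = 1; in the last block it is k itself, with κ a diagonal entry of Δ.
  coordinate : δ ≤ 2 → IsUnit d → IsUnit (- z) → ∀ k → ∃ λ y → ∃ λ κ → IsUnit κ × (∀ v → B y v ≈ κ * v k)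
  coordinate δ≤2 ud uz k with region (toℕ k)
  ... | upper p = e (suc (toℕ k ℕ.+ ν)) , 1# , unit-1 , λ v → trans (B-upper k p v) (sym (*-identityˡ _))
  ... | middle (ν≤k , k<2ν) = e (suc (toℕ k ℕ.∸ ν)) , 1# , unit-1 , λ v →
          trans (B-middle (toℕ k ℕ.∸ ν) k k∸ν<ν (≡.sym (ℕP.m∸n+n≡m ν≤k)) v) (sym (*-identityˡ _))
    where k∸ν<ν = ℕP.+-cancelʳ-< ν _ _ (ℕP.≤-<-trans (ℕP.≤-reflexive (ℕP.m∸n+n≡m ν≤k)) (ℕP.<-≤-trans k<2ν (ℕP.≤-reflexive 2ν≡ν+ν)))
  ... | lower p = basis k , _ , Δe-unit δ≤2 ud uz
          (ℕP.+-cancelˡ-< (2 ℕ.* ν) _ _ (ℕP.≤-<-trans (ℕP.≤-reflexive (ℕP.m+[n∸m]≡n p)) (FinP.toℕ<n k))) ,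
              B-lower k p

-- Vertices congruent to [e₁] modulo p.

module Reduction {c ℓ} (R : CommutativeRing c ℓ) (p s m : ℕ) (p-prime : Prime p)
    (galois : Orth.IsGaloisRing R p s m)
    (h : CommutativeRing.Carrier R) (h+h≈1 : Basics.IsHalf R h)
    {n : ℕ} (S : Orth.Matrix R n) (S-sym : Basics.Symmetric R S)
    {e₁ f₁ : Orth.Vector R n} (H₁ : Moves.Hyperbolic R S S-sym h h+h≈1 e₁ f₁) where
  open CommutativeRing R hiding (zero)
  open Orth R
  open IntegerSolver R
  open Basics R
  open Forms R S S-sym
  open Moves R S S-sym h h+h≈1
  open Stabilizer H₁
  open GaloisRing R p s m p-prime galois h h+h≈1

  proj-B : ∀ v {y} → Perp y → B (proj v) y ≈ B v y
  proj-B v {y} y⊥ = trans (sym (hyp-perp (proj-perp v) (B v f₁) (B v e₁) y⊥))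
      (B-cong (≋-sym (proj-decompose v)) (λ _ → refl))

  -- The shape of a vertex congruent, but not equal, to [e₁] modulo p.
  record Deep (α : V) : Set (c ⊔ ℓ) where
    field
      b : Carrier
      r : ℕ
      1≤r : 1 ≤ r
      r<s : r < s
      v : V
      α∼ : α ∼ hyp 1# b (pw p r ∙ proj v)
      position : Fin n
      unit : IsUnit (v position)
      hidden-e₁ : ¬ IsUnit (B v e₁)
      hidden-f₁ : ¬ IsUnit (B v f₁)

  -- As `proj α` and B(α,e₁) contribute no unit, the unit coordinate of α must come from the
  -- e₁-term, so B(α,f₁) is a unit and can be scaled to 1. If the rest w were 0, isotropy would give
  -- b = 0 and α ∼ e₁; hence w has a primitive part.
  deepen : ∀ {α} → (∃ λ i → IsUnit (α i)) → B α α ≈ 0# → ¬ (α ∼ e₁) →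
           ¬ IsUnit (B α e₁) → (∀ i → ¬ IsUnit (proj α i)) → Deep α
  deepen {α} (i₀ , unit₀) norm α≁e₁ nb none = [ flat , deep ]′ (primitive-part w)
    where
    a-unit : IsUnit (B α f₁)
    a-unit = unit-*ˡ ([ (λ u → [ (λ u → ⊥-elim (none i₀ u)) , (λ u → u) ]′ (unit-+⇒⊎ u)) ,
        (λ u → ⊥-elim (nb (unit-*ˡ u))) ]′
      (unit-+⇒⊎ (unit-cong (proj-decompose α i₀) unit₀)))
    a′ = proj₁ a-unit
    b = a′ * B α e₁
    w = a′ ∙ proj α
    w⊥ = Perp-∙ a′ (proj-perp α)
    α∼ : α ∼ hyp 1# b w
    α∼ = ∼-trans (≋⇒∼ (proj-decompose α)) (unit-hyp∼ (proj₂ a-unit))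
    flat : (∀ i → w i ≈ 0#) → Deep α
    flat w≈0 = ⊥-elim (α≁e₁ (∼-trans α∼ (≋⇒∼ (λ i → combine₂ _ _ (w≈0 i) b≈0
      (solve 4 (λ b w e f → w :+ :1 :* e :+ b :* f := e :+ :1 :* (w :- :0) :+ f :* (b :- :0)) refl _ _ _
          _)))))
      where
      b≈0 : b ≈ 0#
      b≈0 = halve (combine₂ _ _ (trans (sym (hyp-norm w⊥ 1# b)) (↝-B (∼⇒↝ α∼) norm))
        (trans (B-cong {y = w} {y′ = w} (λ i → trans (w≈0 i) (sym (zeroˡ (w i)))) (λ _ → refl))
            (trans (B-∙ˡ 0# w w) (zeroˡ _)))
        (solve 2 (λ b ww → b :+ b := (:0 :+ :0) :+ :1 :* ((:1 :* b :+ :1 :* b) :+ ww :- :0)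
            :+ (:- :1) :* (ww :- :0)) refl _ _))
    deep : Primitive-part w → Deep α
    deep part = record
      { b = b ; r = P.r ; 1≤r = P.positive (λ i u → none i (unit-*ʳ u)) ; r<s = P.r<s ; v = P.part
      ; α∼ = ∼-trans α∼ (≋⇒∼ (hyp-cong refl refl w≋))
      ; position = P.position ; unit = P.unit ; hidden-e₁ = hidden (proj₁ w⊥) ; hidden-f₁ = hidden (proj₂ w⊥)
          }
      where
      module P = Primitive-part part
      annihilated : ∀ x → B w x ≈ 0# → pw p P.r * B P.part x ≈ 0#
      annihilated x wx = trans (sym (B-∙ˡ (pw p P.r) P.part x)) (trans (B-cong (≋-sym P.factors) (λ _ → refl))
          wx)
      -- Only pʳ B(v,x) = 0 is known, not B(v,x) = 0. As pʳ is nonzero, B(v,x) is at least not a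
      -- unit.
      hidden : ∀ {x} → B w x ≈ 0# → ¬ IsUnit (B P.part x)
      hidden {x} wx u = pw-nonzero P.r<s (unit-cancelˡ u (trans (*-comm _ _) (annihilated x wx)))
      -- Replacing v by its projection restores orthogonality at no cost, since pʳ annihilates the
      -- removed components.
      w≋ : w ≋ (pw p P.r ∙ proj P.part)
      w≋ i = trans (P.factors i) (combine₂ _ _ (annihilated e₁ (proj₁ w⊥)) (annihilated f₁ (proj₂ w⊥))
        (solve 6 (λ q v a b e f → q :* v := q :* (v :+ :- a :* e :+ :- b :* f) :+ f :* (q :* b :- :0)
            :+ e :* (q :* a :- :0)) refl _ _ _ _ _ _))

-- Rank ν ≥ 2: two orthogonal hyperbolic pairs.

module HigherRank {c ℓ} (R : CommutativeRing c ℓ) (p s m : ℕ) (p-prime : Prime p)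
    (galois : Orth.IsGaloisRing R p s m)
    (h : CommutativeRing.Carrier R) (h+h≈1 : Basics.IsHalf R h)
    (z : CommutativeRing.Carrier R) (z-nonSquare : Orth.IsNonSquareUnit R z)
    {n : ℕ} (S : Orth.Matrix R n) (S-sym : Basics.Symmetric R S)
    {e₁ f₁ e₂ f₂ : Orth.Vector R n}
    (H₁ : Moves.Hyperbolic R S S-sym h h+h≈1 e₁ f₁) (H₂ : Moves.Hyperbolic R S S-sym h h+h≈1 e₂ f₂)
    (e₂⊥ : Moves.Stabilizer.Perp R S S-sym h h+h≈1 H₁ e₂)
    (f₂⊥ : Moves.Stabilizer.Perp R S S-sym h h+h≈1 H₁ f₂) where
  open CommutativeRing R hiding (zero)
  open Orth R
  open IntegerSolver R
  open Forms R S S-sym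
  open Moves R S S-sym h h+h≈1
  open Stabilizer H₁
  open GaloisRing R p s m p-prime galois h h+h≈1
  open Reduction R p s m p-prime galois h h+h≈1 S S-sym H₁
  open Hyperbolic

  -- A basis-free stand-in for a unit coordinate outside e₁ and f₁; the vector y plays the dual of a
  -- coordinate outside both planes.
  Visible : V → Set (c ⊔ ℓ)
  Visible v = IsUnit (B v e₂) ⊎ IsUnit (B v f₂)
    ⊎ (∃ λ y → Perp y × B y e₂ ≈ 0# × B y f₂ ≈ 0# × IsUnit (B v y))

  plane : Carrier → Carrier → V
  plane a b = (a ∙ e₂) ⊕ (b ∙ f₂)

  B-plane : ∀ a b y → B (plane a b) y ≈ a * B e₂ y + b * B f₂ y
  B-plane a b y = trans (B-⊕ˡ (a ∙ e₂) (b ∙ f₂) y) (+-cong (B-∙ˡ a e₂ y) (B-∙ˡ b f₂ y))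

  plane-e₂ : ∀ a b → B (plane a b) e₂ ≈ b
  plane-e₂ a b = trans (B-plane a b e₂) (combine₂ _ _ (xx≈0 H₂) (yx≈1 H₂)
    (solve 4 (λ a b ee fe → a :* ee :+ b :* fe := b :+ a :* (ee :- :0) :+ b :* (fe :- :1)) refl _ _ _ _))

  plane-f₂ : ∀ a b → B (plane a b) f₂ ≈ a
  plane-f₂ a b = trans (B-plane a b f₂) (combine₂ _ _ (xy≈1 H₂) (yy≈0 H₂)
    (solve 4 (λ a b ef ff → a :* ef :+ b :* ff := a :+ a :* (ef :- :1) :+ b :* (ff :- :0)) refl _ _ _ _))

  plane-norm : ∀ a b → B (plane a b) (plane a b) ≈ a * b + a * b
  plane-norm a b = trans (B-plane a b _) (trans
    (+-cong (*-congˡ (trans (B-sym e₂ _) (plane-e₂ a b))) (*-congˡ (trans (B-sym f₂ _) (plane-f₂ a b))))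
    (+-congˡ (*-comm b a)))

  plane-perp : ∀ a b → Perp (plane a b)
  plane-perp a b =
    trans (B-plane a b e₁) (combine₂ _ _ (proj₁ e₂⊥) (proj₁ f₂⊥) (solve 4 (λ a b x y → a :* x :+ b :* y
        := :0 :+ a :* (x :- :0) :+ b :* (y :- :0)) refl _ _ _ _)) ,
    trans (B-plane a b f₁) (combine₂ _ _ (proj₂ e₂⊥) (proj₂ f₂⊥) (solve 4 (λ a b x y → a :* x :+ b :* y
        := :0 :+ a :* (x :- :0) :+ b :* (y :- :0)) refl _ _ _ _))

  plane-scale : ∀ a b {u v} → u * v ≈ 1# → plane a b ⇝ plane (u * a) (v * b)
  plane-scale a b {u} {v} uv = ⇝-trans (⇝-Φ (scaling H₂ uv) (scaling H₂ (trans (*-comm v u) uv)) e₂⊥ f₂⊥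
      (plane a b))
    (≋⇒⇝ (λ i → combine₂ _ _ (plane-e₂ a b) (plane-f₂ a b)
      (solve 8 (λ u v a b e f αe αf → (a :* e :+ b :* f) :+ (:0 :* αe :+ (u :- :1) :* αf) :* e
          :+ ((v :- :1) :* αe :+ :0 :* αf) :* f
        := (u :* a :* e :+ v :* b :* f) :+ ((v :- :1) :* f) :* (αe :- b) :+ ((u :- :1) :* e) :* (αf :- a))
            refl _ _ _ _ _ _ _ _)))

  -- A unit B(w,e₂) is exchanged with B(w,f₂) by a reflection. If both pairings are nonunits, an
  -- Eichler transformation along e₂ adds the unit B(w,y) to B(w,f₂).
  expose-f₂ : ∀ w → Visible w → ∃ λ w₁ → (w ⇝ w₁) × IsUnit (B w₁ f₂)
  expose-f₂ w visible with unit? (B w f₂) | unit? (B w e₂)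
  ... | yes u | _ = w , ≋⇒⇝ (λ _ → refl) , u
  ... | no _ | yes u = _ , ⇝-reflect xxq (Perp-lc 0# (- 1#) e₂⊥ e₂⊥ f₂⊥) w , unit-cong (sym swapped) u
    where
    -- x = e₂ - f₂ has norm -2, whose inverse is -h; its reflection swaps e₂ and f₂.
    x = lc e₂ 0# e₂ (- 1#) f₂
    xf : B x f₂ ≈ 1#
    xf = trans (B-lcˡ e₂ 0# e₂ (- 1#) f₂ f₂) (combine₂ _ _ (xy≈1 H₂) (yy≈0 H₂)
      (solve 2 (λ ef ff → ef :+ :0 :* ef :+ :- :1 :* ff := :1 :+ :1 :* (ef :- :1) :+ (:- :1) :* (ff :- :0))
          refl _ _))
    xe : B x e₂ ≈ - 1#
    xe = trans (B-lcˡ e₂ 0# e₂ (- 1#) f₂ e₂) (combine₂ _ _ (xx≈0 H₂) (yx≈1 H₂)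
      (solve 2 (λ ee fe → ee :+ :0 :* ee :+ :- :1 :* fe := :- :1 :+ :1 :* (ee :- :0) :+ (:- :1) :* (fe :- :1))
          refl _ _))
    xxq : B x x * - h ≈ 1#
    xxq = trans (*-congʳ (B-lcʳ x e₂ 0# e₂ (- 1#) f₂)) (combine₃ _ _ _ xe xf h+h≈1
      (solve 3 (λ h xe xf → (xe :+ :0 :* xe :+ :- :1 :* xf) :* :- h
          := :1 :+ (:- h) :* (xe :- :- :1) :+ h :* (xf :- :1) :+ :1 :* (h :+ h :- :1)) refl _ _ _))
    swapped : B (w ⊕ (- (- h + - h) * B w x) ∙ x) f₂ ≈ B w e₂
    swapped = trans (trans (B-⊕ˡ w _ f₂) (+-congˡ (B-∙ˡ _ x f₂))) (combine₃ _ _ _ xf h+h≈1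
        (B-lcʳ w e₂ 0# e₂ (- 1#) f₂)
      (solve 5 (λ h we wf wx xf → wf :+ (:- (:- h :+ :- h) :* wx) :* xf
        := we :+ (:- (:- h :+ :- h) :* wx) :* (xf :- :1) :+ wx :* (h :+ h :- :1)
            :+ :1 :* (wx :- (we :+ :0 :* we :+ :- :1 :* wf))) refl _ _ _ _ _))
  ... | no nf | no ne with visible
  ...   | inj₁ u = ⊥-elim (ne u)
  ...   | inj₂ (inj₁ u) = ⊥-elim (nf u)
  ...   | inj₂ (inj₂ (y , y⊥ , ye , yf , u)) = _ ,
          ⇝-Φ (eichler⁺ (xx≈0 H₂) (trans (B-sym e₂ y) ye)) (eichler⁻ (xx≈0 H₂) (trans (B-sym e₂ y) ye)) e₂⊥ y⊥
              w ,
          unit-cong (sym moved) (unit+nonunit u (nonunit-+ nf (nonunit-*ʳ _ ne)))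
    where
    moved : B (Φ e₂ y (- (h * B y y)) 1# (- 1#) 0# w) f₂ ≈ B w y + (B w f₂ + - (h * B y y) * B w e₂)
    moved = trans (B-lcˡ w _ e₂ _ y f₂) (combine₂ _ _ (xy≈1 H₂) yf
      (solve 6 (λ k we wf wy ef yf → wf :+ (k :* we :+ :1 :* wy) :* ef :+ (:- :1 :* we :+ :0 :* wy) :* yf
        := wy :+ (wf :+ k :* we) :+ (k :* we :+ wy) :* (ef :- :1) :+ (:- we) :* (yf :- :0)) refl _ _ _ _ _ _))

  -- The Eichler transformation along f₂ subtracts B(w,f₂) x. Choosing x as the component r of w
  -- orthogonal to the plane, divided by the unit B(w,f₂), makes it subtract exactly r.
  into-plane : ∀ {w u′} → Perp w → B w f₂ * u′ ≈ 1# → ∃ λ b → w ⇝ plane (B w f₂) b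
  into-plane {w} {u′} w⊥ uu′ = b , ⇝-trans (⇝-Φ (eichler⁺ (yy≈0 H₂) fx) (eichler⁻ (yy≈0 H₂) fx) f₂⊥ x⊥ w)
      (≋⇒⇝ shape)
    where
    u = B w f₂
    r = lc w (- u) e₂ (- B w e₂) f₂
    x = u′ ∙ r
    x⊥ = Perp-∙ u′ (Perp-lc (- u) (- B w e₂) w⊥ e₂⊥ f₂⊥)
    fx : B f₂ x ≈ 0#
    fx = trans (B-sym f₂ x) (trans (B-∙ˡ u′ r f₂) (trans (*-congˡ (B-lcˡ w (- u) e₂ (- B w e₂) f₂ f₂))
      (combine₂ _ _ (xy≈1 H₂) (yy≈0 H₂) (solve 5 (λ u u′ we ef ff → u′ :* (u :+ :- u :* ef :+ :- we :* ff)
        := :0 :+ (:- (u′ :* u)) :* (ef :- :1) :+ (:- (u′ :* we)) :* (ff :- :0)) refl _ _ _ _ _))))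
    b = B w e₂ + (- (h * B x x) * u + B w x)
    shape : Φ f₂ x (- (h * B x x)) 1# (- 1#) 0# w ≋ plane u b
    shape i = combine₁ _ uu′ (solve 8 (λ k u u′ we wx w e f → w :+ (k :* u :+ :1 :* wx) :* f
        :+ (:- :1 :* u :+ :0 :* wx) :* (u′ :* (w :+ :- u :* e :+ :- we :* f))
      := u :* e :+ (we :+ (k :* u :+ wx)) :* f :+ (:- (w :+ :- u :* e :+ :- we :* f)) :* (u :* u′ :- :1)) refl
          _ _ _ _ _ _ _ _)

  normalize : ∀ {w} → Perp w → Visible w → ∃ λ q → w ⇝ plane 1# q
  normalize {w} w⊥ visible =
    let w₁ , w⇝w₁ , u′ , uu′ = expose-f₂ w visible
        b , w₁⇝plane = into-plane (⇝-perp w⇝w₁ w⊥) uu′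
        u = B w₁ f₂
    in u * b , ⇝-trans w⇝w₁ (⇝-trans w₁⇝plane (⇝-trans (plane-scale u b (trans (*-comm u′ u) uu′))
         (≋⇒⇝ (λ i → +-congʳ (*-congʳ (trans (*-comm u′ u) uu′))))))

  Reached : V → Set (c ⊔ ℓ)
  Reached α = α ↝ f₁
    ⊎ α ↝ e₂
    ⊎ (∃ λ r → 1 ≤ r × r ≤ s ℕ.∸ 1 × α ↝ (λ i → e₂ i + pw p r * f₁ i))
    ⊎ (∃ λ r → 1 ≤ r × r ≤ s ℕ.∸ 1 × α ↝ (λ i → e₁ i + pw p r * e₂ i))
    ⊎ (∃ λ r → ∃ λ t → 1 ≤ r × r ≤ t × t ≤ s ℕ.∸ 1 × Σ Carrier λ a → (a ≈ 1# ⊎ a ≈ z) ×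
         α ↝ (λ i → e₁ i + pw p r * e₂ i - a * pw p (r ℕ.+ t) * f₁ i + a * pw p t * f₂ i))

  Reached-↝ : ∀ {α β} → α ↝ β → Reached β → Reached α
  Reached-↝ α↝β (inj₁ q) = inj₁ (↝-trans α↝β q)
  Reached-↝ α↝β (inj₂ (inj₁ q)) = inj₂ (inj₁ (↝-trans α↝β q))
  Reached-↝ α↝β (inj₂ (inj₂ (inj₁ (r , lb , ub , q)))) = inj₂ (inj₂ (inj₁ (r , lb , ub , ↝-trans α↝β q)))
  Reached-↝ α↝β (inj₂ (inj₂ (inj₂ (inj₁ (r , lb , ub , q))))) = inj₂
      (inj₂ (inj₂ (inj₁ (r , lb , ub , ↝-trans α↝β q))))
  Reached-↝ α↝β (inj₂ (inj₂ (inj₂ (inj₂ (r , t , lb , mid , ub , a , choice , q))))) =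
    inj₂ (inj₂ (inj₂ (inj₂ (r , t , lb , mid , ub , a , choice , ↝-trans α↝β q))))

  <⇒≤∸1 : ∀ {r} → r < s → r ≤ s ℕ.∸ 1
  <⇒≤∸1 (ℕ.s≤s r≤) = r≤

  nonunit-pw : ∀ {r u x} → ¬ IsUnit x → IsUnit u → x ≈ pw p r * u → 1 ≤ r
  nonunit-pw {suc r} _ _ _ = ℕ.s≤s ℕ.z≤n
  nonunit-pw {zero} nx uu eq = ⊥-elim (nx (unit-cong (sym (trans eq (trans (*-congʳ pw-0) (*-identityˡ _))))
      uu))

  visible-reached : ∀ {a b w} → Perp w → Visible w → B (hyp a b w) (hyp a b w) ≈ 0# → ¬ IsUnit b → Reached
      (hyp a b w)
  visible-reached {a} {b} {w} w⊥ visible norm nb = conclude (normalize w⊥ visible)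
    where
    conclude : (∃ λ q → w ⇝ plane 1# q) → Reached (hyp a b w)
    conclude (q , w⇝) = [ zero-case , nonzero-case ]′ (valuation b)
      where
      P = plane 1# q
      P⊥ = plane-perp 1# q
      -- B(P,y) = -a cancels the coefficient of e₁, and the shift -b y = a b f₂ cancels q f₂,
      -- because isotropy gives a b + q = 0.
      y = (- a) ∙ f₂
      step₁ : hyp a b w ↝ hyp a b P
      step₁ = ↝-trans (≋⇒↝ (hyp-cong refl refl (λ i → sym (*-identityˡ _))))
        (↝-trans (lift a b 1# w⇝) (≋⇒↝ (hyp-cong refl refl (λ i → *-identityˡ _))))
      ab+q≈0 : a * b + q ≈ 0#
      ab+q≈0 = halve (combine₂ _ _ (trans (sym (hyp-norm P⊥ a b)) (↝-B step₁ norm)) (plane-norm 1# q)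
        (solve 4 (λ a b q pp → (a :* b :+ q) :+ (a :* b :+ q)
            := (:0 :+ :0) :+ :1 :* ((a :* b :+ a :* b) :+ pp :- :0)
            :+ (:- :1) :* (pp :- (:1 :* q :+ :1 :* q))) refl _ _ _ _))
      Py : B P y ≈ - a
      Py = trans (B-∙ʳ P (- a) f₂) (trans (*-congˡ (plane-f₂ 1# q)) (*-identityʳ _))
      yy : B y y ≈ 0#
      yy = trans (B-∙ˡ (- a) f₂ y)
          (trans (*-congˡ (trans (B-∙ʳ f₂ (- a) f₂) (trans (*-congˡ (yy≈0 H₂)) (zeroʳ _)))) (zeroʳ _))
      step₂ : hyp a b P ↝ hyp 0# b e₂
      step₂ = ↝-trans (hyp-eichler P⊥ a b (Perp-∙ (- a) f₂⊥)) (≋⇒↝ (hyp-cong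
        (combine₂ _ _ Py yy (solve 5 (λ h a b py yy → a :+ (py :- h :* yy :* b)
            := :0 :+ :1 :* (py :- :- a) :+ (:- (h :* b)) :* (yy :- :0)) refl _ _ _ _ _))
        refl
        (λ i → combine₁ _ ab+q≈0 (solve 5 (λ a b q e f → (:1 :* e :+ q :* f) :+ :- b :* (:- a :* f)
            := e :+ f :* (a :* b :+ q :- :0)) refl _ _ _ _ _))))
      zero-case : b ≈ 0# → Reached (hyp a b w)
      zero-case b≈0 = inj₂ (inj₁ (↝-trans step₁ (↝-trans step₂ (≋⇒↝ (λ i →
        combine₁ _ b≈0 (solve 4 (λ b g e f → g :+ :0 :* e :+ b :* f := g :+ f :* (b :- :0)) refl _ _ _ _))))))
      nonzero-case : (∃ λ r → ∃ λ u → r < s × IsUnit u × b ≈ pw p r * u) → Reached (hyp a b w)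
      nonzero-case (r , u , r<s , (u′ , uu′) , eq) = inj₂
          (inj₂ (inj₁ (r , nonunit-pw nb (u′ , uu′) eq , <⇒≤∸1 r<s ,
        -- Dividing the f₁-coefficient by u multiplies that of e₁ by u, which is harmless as the
        -- latter is 0.
        ↝-trans step₁ (↝-trans step₂ (↝-trans (hyp-scale e₂⊥ 0# b uu′) (≋⇒↝ (λ i → combine₂ _ _ eq uu′
          (solve 7 (λ b u u′ q g e f → g :+ (u :* :0) :* e :+ (u′ :* b) :* f
              := g :+ q :* f :+ (u′ :* f) :* (b :- q :* u) :+ (q :* f) :* (u :* u′ :- :1)) refl _ _ _ _ _ _
              _))))))))

  -- With the rest moved to pʳ (e₂ + q f₂), isotropy gives b = -p²ʳ q. So pʳ q = 0 kills the terms
  -- in f₁ and f₂ together; otherwise only the unit part of q remains to be normalised.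
  deep-reached : ∀ {α} (D : Deep α) → Visible (Deep.v D) → B α α ≈ 0# → Reached α
  deep-reached {α} D visible norm = conclude (normalize (proj-perp v) visible-proj)
    where
    open Deep D
    ϖ = pw p r
    visible-proj : Visible (proj v)
    visible-proj = [ (λ u → inj₁ (unit-cong (sym (proj-B v e₂⊥)) u)) , (λ rest → inj₂
      ([ (λ u → inj₁ (unit-cong (sym (proj-B v f₂⊥)) u))
       , (λ (y , y⊥ , ye , yf , u) → inj₂ (y , y⊥ , ye , yf , unit-cong (sym (proj-B v y⊥)) u)) ]′ rest)) ]′
           visible
    conclude : (∃ λ q → proj v ⇝ plane 1# q) → Reached α
    conclude (q , v⇝) = [ (λ q≈0 → flat (trans (*-congˡ q≈0) (zeroʳ _))) , graded ]′ (valuation q)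
      where
      step : α ↝ hyp 1# b (ϖ ∙ plane 1# q)
      step = ↝-trans (∼⇒↝ α∼) (lift 1# b ϖ v⇝)
      b≈ : b + ϖ * (ϖ * q) ≈ 0#
      b≈ = halve (combine₂ _ _
        (trans (sym (hyp-norm (Perp-∙ ϖ (plane-perp 1# q)) 1# b)) (↝-B step norm))
        (trans (B-∙ˡ ϖ _ _) (*-congˡ (trans (B-∙ʳ _ ϖ _) (*-congˡ (plane-norm 1# q)))))
        (solve 4 (λ b t q pp → (b :+ t :* (t :* q)) :+ (b :+ t :* (t :* q))
            := (:0 :+ :0) :+ :1 :* ((:1 :* b :+ :1 :* b) :+ pp :- :0)
           :+ (:- :1) :* (pp :- t :* (t :* (:1 :* q :+ :1 :* q)))) refl _ _ _ _))
      flat : ϖ * q ≈ 0# → Reached α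
      flat ϖq≈0 = inj₂ (inj₂ (inj₂ (inj₁ (r , 1≤r , <⇒≤∸1 r<s , ↝-trans step (≋⇒↝ (λ i →
        combine₂ _ _ ϖq≈0 b≈ (solve 7 (λ b t q e₁ f₁ e₂ f₂ → t :* (:1 :* e₂ :+ q :* f₂) :+ :1 :* e₁ :+ b :* f₁
          := e₁ :+ t :* e₂ :+ (f₂ :- t :* f₁) :* (t :* q :- :0) :+ f₁ :* (b :+ t :* (t :* q) :- :0)) refl _ _
              _ _ _ _ _)))))))
      graded : (∃ λ k → ∃ λ u → k < s × IsUnit u × q ≈ pw p k * u) → Reached α
      graded (k , u , _ , uu , q≈) with r ℕ.+ k ℕ.<? s
      ... | no t≮s = flat (trans (*-congˡ q≈) (trans (sym (*-assoc ϖ _ _))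
              (trans (*-congʳ (trans (sym (pw-+ r k)) (pw-vanishes (ℕP.≮⇒≥ t≮s)))) (zeroˡ _))))
      ... | yes t<s = scaled (unit-square-class z-nonSquare uu)
        where
        -- The coefficient of f₂ is pʳ q, of valuation r + k, whence r ≤ t; that of f₁ is -p²ʳ q, of
        -- exponent r + t.
        t = r ℕ.+ k
        scaled : (∃ λ a → ∃ λ x → (a ≈ 1# ⊎ a ≈ z) × IsUnit x × u ≈ a * (x * x)) → Reached α
        scaled (a , x , a-choice , (x′ , xx′) , u≈) = inj₂ (inj₂ (inj₂ (inj₂
          (r , t , 1≤r , ℕP.m≤m+n r k , <⇒≤∸1 t<s , a , a-choice ,
           -- Multiply e₁ and e₂ by x, f₁ and f₂ by its inverse, then divide the whole vector by x.
           -- The part e₁ + pʳ e₂ returns to itself, while b and q are divided by x².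
           ↝-trans step (↝-trans (lift 1# b ϖ (plane-scale 1# q xx′)) (↝-trans
             (hyp-scale (Perp-∙ ϖ (plane-perp _ _)) 1# b xx′) (↝-trans
             (∼⇒↝ (unit-hyp∼ (trans (*-congʳ (*-identityʳ x)) xx′))) (≋⇒↝ shape))))))))
          where
          x′x′q≈ : x′ * x′ * q ≈ a * pw p k
          x′x′q≈ = combine₃ _ _ _ q≈ u≈ xx′ (solve 6 (λ x x′ q u a t → x′ :* x′ :* q
            := a :* t :+ (x′ :* x′) :* (q :- t :* u) :+ (x′ :* x′ :* t) :* (u :- a :* (x :* x))
                :+ (a :* t :* (x :* x′ :+ :1)) :* (x :* x′ :- :1)) refl _ _ _ _ _ _)
          shape : hyp 1# (x′ * (x′ * b)) (x′ ∙ (ϖ ∙ plane (x * 1#) (x′ * q)))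
                  ≋ (λ i → e₁ i + ϖ * e₂ i - a * pw p (r ℕ.+ t) * f₁ i + a * pw p t * f₂ i)
          shape i = trans
            (combine₃ _ _ _ xx′ b≈ x′x′q≈
              (solve 11 (λ x x′ b t q a y e₁ f₁ e₂ f₂ → x′ :* (t :* (x :* :1 :* e₂ :+ x′ :* q :* f₂))
                  :+ :1 :* e₁ :+ x′ :* (x′ :* b) :* f₁
                := (e₁ :+ t :* e₂ :- a :* (t :* (t :* y)) :* f₁ :+ a :* (t :* y) :* f₂)
                    :+ (t :* e₂) :* (x :* x′ :- :1)
                  :+ (x′ :* x′ :* f₁) :* (b :+ t :* (t :* q) :- :0)
                      :+ (t :* f₂ :- t :* t :* f₁) :* (x′ :* x′ :* q :- a :* y)) refl _ _ _ _ _ _ _ _ _ _ _))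
            (+-cong (+-congˡ (-‿cong (*-congʳ (*-congˡ (sym (trans (pw-+ r t) (*-congˡ (pw-+ r k))))))))
                    (*-congʳ (*-congˡ (sym (pw-+ r k)))))

  module _ (detect : ∀ v i → IsUnit (v i) → IsUnit (B v e₁) ⊎ IsUnit (B v f₁) ⊎ Visible v) where
    -- `detect` is where coordinates enter. It is applied to `proj α` or to the primitive vector of
    -- `Deep`; the alternatives e₁ and f₁ are excluded by orthogonality in the first case and by the
    -- `hidden` fields in the second.
    vertex-reached : ∀ α → (∃ λ i → IsUnit (α i)) → B α α ≈ 0# → ¬ (α ∼ e₁) → Reached α
    vertex-reached α (i₀ , unit₀) norm α≁e₁ with unit? (B α e₁) | FinP.any? (λ i → unit? (proj α i))
    ... | yes u | _ = inj₁ (reach-f₁ u norm)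
    ... | no nb | yes (i , u) = Reached-↝ (≋⇒↝ (proj-decompose α))
        (visible-reached (proj-perp α) visible (↝-B (≋⇒↝ (proj-decompose α)) norm) nb)
      where
      nonunit : ∀ {x} → x ≈ 0# → ¬ IsUnit x
      nonunit eq ux = nonunit-0 (unit-cong eq ux)
      visible : Visible (proj α)
      visible = [ (λ u → ⊥-elim (nonunit (proj₁ (proj-perp α)) u)) ,
        [ (λ u → ⊥-elim (nonunit (proj₂ (proj-perp α)) u)) , (λ x → x) ]′ ]′ (detect (proj α) i u)
    ... | no nb | no none = deep-reached D visible norm
      where
      D = deepen (i₀ , unit₀) norm α≁e₁ nb (λ i u → none (i , u))
      visible : Visible (Deep.v D)
      visible = [ (λ u → ⊥-elim (Deep.hidden-e₁ D u)) ,
        [ (λ u → ⊥-elim (Deep.hidden-f₁ D u)) , (λ x → x) ]′ ]′ (detect (Deep.v D) (Deep.position D)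
            (Deep.unit D))

-- Rank ν = 1: an anisotropic complement of the hyperbolic plane.

module RankOne {c ℓ} (R : CommutativeRing c ℓ) (p s m : ℕ) (p-prime : Prime p)
    (galois : Orth.IsGaloisRing R p s m)
    (h : CommutativeRing.Carrier R) (h+h≈1 : Basics.IsHalf R h)
    {n : ℕ} (S : Orth.Matrix R n) (S-sym : Basics.Symmetric R S)
    {e₁ f₁ : Orth.Vector R n} (H₁ : Moves.Hyperbolic R S S-sym h h+h≈1 e₁ f₁) where
  open CommutativeRing R hiding (zero)
  open Orth R
  open IntegerSolver R
  open Basics R
  open Forms R S S-sym
  open Moves R S S-sym h h+h≈1
  open Stabilizer H₁
  open GaloisRing R p s m p-prime galois h h+h≈1
  open Reduction R p s m p-prime galois h h+h≈1 S S-sym H₁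

  -- For u = x + y with B(x,x) = B(y,y), the reflection in u sends x to −y.
  ⇝-difference : ∀ {x u} → Perp u → IsUnit (B u u) → B x u + B x u ≈ B u u → x ⇝ (x ⊕ (- 1#) ∙ u)
  ⇝-difference {x} {u} u⊥ (q , uuq) eq = ⇝-trans (⇝-reflect uuq u⊥ x)
    (≋⇒⇝ (λ i → combine₂ _ _ eq uuq (solve 5 (λ q xu uu x u → x :+ :- (q :+ q) :* xu :* u
      := x :+ :- :1 :* u :+ (:- (q :* u)) :* (xu :+ xu :- uu) :+ (:- u) :* (uu :* q :- :1)) refl _ _ _ _ _)))

  -- Isotropy gives B(w,w) = -2ab for w = `proj α`. If b is a nonunit so is this norm, and
  -- anisotropy then forbids unit entries in w.
  vertex-dichotomy : (∀ {w} → Perp w → ¬ IsUnit (B w w) → ∀ i → ¬ IsUnit (w i)) →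
    ∀ {α} → (∃ λ i → IsUnit (α i)) → B α α ≈ 0# → ¬ (α ∼ e₁) → α ↝ f₁ ⊎ Deep α
  vertex-dichotomy anisotropic-perp {α} prim norm α≁e₁ with unit? (B α e₁)
  ... | yes u = inj₁ (reach-f₁ u norm)
  ... | no nb = inj₂ (deepen prim norm α≁e₁ nb (anisotropic-perp (proj-perp α) nonunit))
    where
    a = B α f₁
    b = B α e₁
    nonunit : ¬ IsUnit (B (proj α) (proj α))
    nonunit u = nonunit-*ʳ (- (a + a)) nb (unit-cong (combine₁ _
      (trans (sym (hyp-norm (proj-perp α) a b)) (↝-B (≋⇒↝ (proj-decompose α)) norm))
      (solve 3 (λ a b q → q := :- (a :+ a) :* b :+ :1 :* ((a :* b :+ a :* b) :+ q :- :0)) refl _ _ _)) u)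

  -- The factor x is absorbed by scaling e₁ by x, f₁ by its inverse, and dividing the whole vector
  -- by x. Isotropy then dictates the coefficient of f₁.
  deep-reached : ∀ {α} (D : Deep α) → B α α ≈ 0# → ∀ {x ω} → IsUnit x → Perp ω → proj (Deep.v D) ⇝ (x ∙ ω) →
    α ↝ hyp 1# (- (h * (B ω ω * pw p (2 ℕ.* Deep.r D)))) (pw p (Deep.r D) ∙ ω)
  deep-reached {α} D norm {x} {ω} (x′ , xx′) ω⊥ v⇝ = ↝-trans step (↝-trans (hyp-scale xω⊥ 1# b xx′) (↝-trans
      (∼⇒↝ (unit-hyp∼ (trans (*-congʳ (*-identityʳ x)) xx′))) (≋⇒↝ (hyp-cong refl coefficient
        (λ i → combine₁ _ xx′ (solve 4 (λ x x′ t w → x′ :* (t :* (x :* w))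
            := t :* w :+ (t :* w) :* (x :* x′ :- :1)) refl _ _ _ _)))))
    )
    where
    open Deep D
    ϖ = pw p r
    xω⊥ : Perp (ϖ ∙ (x ∙ ω))
    xω⊥ = Perp-∙ ϖ (Perp-∙ x ω⊥)
    step : α ↝ hyp 1# b (ϖ ∙ (x ∙ ω))
    step = ↝-trans (∼⇒↝ α∼) (lift 1# b ϖ v⇝)
    norm′ : (1# * b + 1# * b) + B (ϖ ∙ (x ∙ ω)) (ϖ ∙ (x ∙ ω)) ≈ 0#
    norm′ = trans (sym (hyp-norm xω⊥ 1# b)) (↝-B step norm)
    expand : B (ϖ ∙ (x ∙ ω)) (ϖ ∙ (x ∙ ω)) ≈ ϖ * (x * (ϖ * (x * B ω ω)))
    expand = trans (B-∙ˡ ϖ _ _)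
        (*-congˡ (trans (B-∙ˡ x _ _) (*-congˡ (trans (B-∙ʳ _ ϖ _) (*-congˡ (B-∙ʳ _ x _))))))
    b≈ : b + h * (ϖ * (x * (ϖ * (x * B ω ω)))) ≈ 0#
    b≈ = halve (combine₃ _ _ _ norm′ expand h+h≈1 (solve 4 (λ b h q qq → (b :+ h :* q) :+ (b :+ h :* q)
      := (:0 :+ :0) :+ :1 :* ((:1 :* b :+ :1 :* b) :+ qq :- :0) :+ (:- :1) :* (qq :- q)
          :+ q :* (h :+ h :- :1)) refl _ _ _ _))
    coefficient : x′ * (x′ * b) ≈ - (h * (B ω ω * pw p (2 ℕ.* r)))
    coefficient = combine₃ _ _ _ b≈ xx′ (pw-2* r) (solve 7 (λ b h t x x′ q tt → x′ :* (x′ :* b)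
      := :- (h :* (q :* tt)) :+ (x′ :* x′) :* (b :+ h :* (t :* (x :* (t :* (x :* q)))) :- :0)
          :+ (:- (h :* t :* t :* q :* (x :* x′ :+ :1))) :* (x :* x′ :- :1)
        :+ (h :* q) :* (tt :- t :* t)) refl _ _ _ _ _ _ _)

-- The Gram matrix of the basis vectors, and the passage from isometries to matrices.

module Vertices {c ℓ} (R : CommutativeRing c ℓ) (d z h : CommutativeRing.Carrier R) (h+h≈1 : Basics.IsHalf R
    h)
    (ν δ : ℕ) (1≤ν : 1 ≤ ν) where
  open CommutativeRing R hiding (zero)
  open Orth R
  open Graph ν δ d z public
  open Coordinates R ν δ d z public
  open Forms R S S-sym public
  open Moves R S S-sym h h+h≈1 public
  open Hyperbolic public

  -- Here t and a count from 0, while `e` counts from 1.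
  gram-e : ∀ t a → t < ν → B (e (suc t)) (e (suc a)) ≈ indicator (t ℕ.+ ν) a
  gram-e t a t<ν = trans (B-middle t (fromℕ< t+ν<n) t<ν (FinP.toℕ-fromℕ< t+ν<n) (e (suc a)))
    (reflexive (≡.cong (λ k → indicator k a) (FinP.toℕ-fromℕ< t+ν<n)))
    where t+ν<n = ℕP.<-≤-trans (ℕP.<-≤-trans (ℕP.+-monoˡ-< ν t<ν) (ℕP.≤-reflexive (≡.sym 2ν≡ν+ν))) (ℕP.m≤m+n (2 ℕ.* ν) δ)

  gram-f : ∀ t a → t < ν → B (e (suc (t ℕ.+ ν))) (e (suc a)) ≈ indicator t a
  gram-f t a t<ν = trans (reflexive (≡.cong (λ k → B (e (suc (k ℕ.+ ν))) (e (suc a))) (≡.sym k≡)))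
    (trans (B-upper (fromℕ< t<n) (≡.subst Upper (≡.sym k≡) t<ν) (e (suc a)))
        (reflexive (≡.cong (λ k → indicator k a) k≡)))
    where
    t<n = ℕP.<-≤-trans t<ν (ℕP.≤-trans ν≤2ν (ℕP.m≤m+n (2 ℕ.* ν) δ))
    k≡ = FinP.toℕ-fromℕ< t<n

  hyperbolic : ∀ t → t < ν → Hyperbolic (e (suc t)) (e (suc (t ℕ.+ ν)))
  hyperbolic t t<ν = record
    { xx≈0 = trans (gram-e t t t<ν) (indicator-≢ (λ eq → upper≢+ν t t<ν (≡.sym eq)))
    ; yy≈0 = trans (gram-f t (t ℕ.+ ν) t<ν) (indicator-≢ (upper≢+ν t t<ν))
    ; xy≈1 = trans (gram-e t (t ℕ.+ ν) t<ν) (indicator-≡ {t ℕ.+ ν} ≡.refl) }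

  H₁ : Hyperbolic (e 1) (e (suc ν))
  H₁ = hyperbolic 0 1≤ν

  open Stabilizer H₁ public

  orbit : ∀ {α β} → α ↝ β → ∃ λ T → InStab T × (α ∼ (β ·M T))
  orbit {α} {β} α↝β = matrix φ , (matrix-orthogonal φ , ∼-trans (≋⇒∼ (·M-matrix φ (e 1))) (fixes α↝β)) ,
    ∼-trans (reaches α↝β) (≋⇒∼ (≋-sym (·M-matrix φ β)))
    where φ = isometry α↝β

-- The orbit claims for each ν and δ.

module OrbitClaims {c ℓ} (R : CommutativeRing c ℓ) (p s m : ℕ) (p-prime : Prime p)
    (galois : Orth.IsGaloisRing R p s m)
    (z : CommutativeRing.Carrier R) (z-nonSquare : Orth.IsNonSquareUnit R z)
    (d : CommutativeRing.Carrier R) (d-unit : Orth.IsUnit R d)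
    (h : CommutativeRing.Carrier R) (h+h≈1 : Basics.IsHalf R h) where
  open CommutativeRing R hiding (zero)
  open Orth R
  open IntegerSolver R
  open Basics R
  open GaloisRing R p s m p-prime galois h h+h≈1
  open Reps p s h z d

  module HigherRankClaim (ν δ : ℕ) (2≤ν : 2 ≤ ν) (δ≤2 : δ ≤ 2) where
    1≤ν : 1 ≤ ν
    1≤ν = ℕP.<⇒≤ 2≤ν

    open Vertices R d z h h+h≈1 ν δ 1≤ν

    e₂⊥ : Perp (e 2)
    e₂⊥ = trans (gram-e 1 0 2≤ν) (indicator-≢ {suc ν} {0} (λ ())) ,
          trans (gram-e 1 ν 2≤ν) (indicator-≢ {suc ν} {ν} ℕP.1+n≢n)

    f₂⊥ : Perp (e (2 ℕ.+ ν))
    f₂⊥ = trans (gram-f 1 0 2≤ν) (indicator-≢ {1} {0} (λ ())) ,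
          trans (gram-f 1 ν 2≤ν) (indicator-≢ (ℕP.<⇒≢ 2≤ν))

    open HigherRank R p s m p-prime galois h h+h≈1 z z-nonSquare S S-sym H₁ (hyperbolic 1 2≤ν) e₂⊥ f₂⊥

    -- Coordinates 0 and 1 are read by f₁ and f₂, coordinates ν and 1 + ν by e₁ and e₂. For any
    -- other coordinate i the dual vector y reads i alone, where e₁, f₁, e₂ and f₂ all vanish; so y
    -- is orthogonal to them.
    detect : ∀ v i → IsUnit (v i) → IsUnit (B v (e 1)) ⊎ IsUnit (B v (e (suc ν))) ⊎ Visible v
    detect v i u with toℕ i ℕ.≟ 0 | toℕ i ℕ.≟ 1 | toℕ i ℕ.≟ ν | toℕ i ℕ.≟ suc ν
    ... | yes i≡0 | _ | _ | _ = inj₂ (inj₁ (unit-cong (sym (trans (B-sym v _)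
            (≡.subst (λ t → B (e (suc (t ℕ.+ ν))) v ≈ v i) i≡0 (B-upper i (≡.subst Upper (≡.sym i≡0) 1≤ν)
                v)))) u))
    ... | no _ | yes i≡1 | _ | _ = inj₂ (inj₂ (inj₂ (inj₁ (unit-cong (sym (trans (B-sym v _)
            (≡.subst (λ t → B (e (suc (t ℕ.+ ν))) v ≈ v i) i≡1 (B-upper i (≡.subst Upper (≡.sym i≡1) 2≤ν)
                v)))) u))))
    ... | no _ | no _ | yes i≡ν | _ = inj₁ (unit-cong (sym (trans (B-sym v _) (B-middle 0 i 1≤ν i≡ν v))) u)
    ... | no _ | no _ | no _ | yes i≡1+ν = inj₂
        (inj₂ (inj₁ (unit-cong (sym (trans (B-sym v _) (B-middle 1 i 2≤ν i≡1+ν v))) u)))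
    ... | no i≢0 | no i≢1 | no i≢ν | no i≢1+ν = inj₂
        (inj₂ (inj₂ (inj₂ (y , (off i≢0 , off i≢ν) , off i≢1 , off i≢1+ν ,
            unit-cong (sym (trans (B-sym v y) (y-reads v))) (unit-* κ-unit u)))))
      where
      dual = coordinate δ≤2 d-unit (unit-neg (proj₁ z-nonSquare)) i
      y = proj₁ dual
      κ = proj₁ (proj₂ dual)
      κ-unit = proj₁ (proj₂ (proj₂ dual))
      y-reads : ∀ v → B y v ≈ κ * v i
      y-reads = proj₂ (proj₂ (proj₂ dual))
      off : ∀ {a} → ¬ (toℕ i ≡ a) → B y (e (suc a)) ≈ 0#
      off {a} i≢a = trans (y-reads (e (suc a))) (trans (*-congˡ (indicator-≢ {toℕ i} {a} i≢a)) (zeroʳ κ))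

    claim : OrbitClaim (Rep2 ν δ)
    claim α (prim , norm) α≁e₁ = represent (vertex-reached detect α prim norm α≁e₁)
      where
      represent : Reached α → ∃ λ β → Rep2 ν δ β × ∃ λ T → InStab T × (α ∼ (β ·M T))
      represent (inj₁ q) = _ , inj₁ (Level.lift (λ _ → refl)) , orbit q
      represent (inj₂ (inj₁ q)) = _ , inj₂ (inj₁ (Level.lift (λ _ → refl))) , orbit q
      represent (inj₂ (inj₂ (inj₁ (r , lb , ub , q)))) =
        _ , inj₂ (inj₂ (inj₁ (r , lb , ub , λ _ → refl))) , orbit q
      represent (inj₂ (inj₂ (inj₂ (inj₁ (r , lb , ub , q))))) =
        _ , inj₂ (inj₂ (inj₂ (inj₁ (r , lb , ub , λ _ → refl)))) , orbit q
      represent (inj₂ (inj₂ (inj₂ (inj₂ (r , t , lb , mid , ub , a , choice , q))))) =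
        _ , inj₂ (inj₂ (inj₂ (inj₂ (r , t , lb , mid , ub , a , choice , λ _ → refl)))) , orbit q

  module RankOneClaims (δ : ℕ) where
    open Vertices R d z h h+h≈1 1 δ (ℕ.s≤s ℕ.z≤n) public
    open Reduction R p s m p-prime galois h h+h≈1 S S-sym H₁ public
    open RankOne R p s m p-prime galois h h+h≈1 S S-sym H₁ public

    B-f₁ : ∀ v → B v (e 2) ≈ v Fin.zero
    B-f₁ v = trans (B-sym v (e 2)) (B-upper Fin.zero (ℕ.s≤s ℕ.z≤n) v)

    B-e₁ : ∀ v → B v (e 1) ≈ v (Fin.suc Fin.zero)
    B-e₁ v = trans (B-sym v (e 1)) (B-middle 0 (Fin.suc Fin.zero) (ℕ.s≤s ℕ.z≤n) ≡.refl v)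

    B-diagonal : ∀ (k : Fin δ) v → B v (basis (Fin.suc (Fin.suc k))) ≈ Δe δ d z (toℕ k) * v
        (Fin.suc (Fin.suc k))
    B-diagonal k v = trans (B-sym v (basis (Fin.suc (Fin.suc k)))) (B-lower (Fin.suc (Fin.suc k))
        (ℕ.s≤s (ℕ.s≤s ℕ.z≤n)) v)

    perp₀ : ∀ w → Perp w → w Fin.zero ≈ 0#
    perp₀ w w⊥ = trans (sym (B-f₁ w)) (proj₂ w⊥)

    perp₁ : ∀ w → Perp w → w (Fin.suc Fin.zero) ≈ 0#
    perp₁ w w⊥ = trans (sym (B-e₁ w)) (proj₁ w⊥)

    ≈0⇒nonunit : ∀ {x} → x ≈ 0# → ¬ IsUnit x
    ≈0⇒nonunit eq u = nonunit-0 (unit-cong eq u)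

    basis⊥ : ∀ k → Perp (basis (Fin.suc (Fin.suc k)))
    basis⊥ k = B-e₁ (basis (Fin.suc (Fin.suc k))) , B-f₁ (basis (Fin.suc (Fin.suc k)))

    proj-diagonal : ∀ v k → proj v (Fin.suc (Fin.suc k)) ≈ v (Fin.suc (Fin.suc k))
    proj-diagonal v k = solve 3 (λ v a b → v :+ :- a :* :0 :+ :- b :* :0 := v) refl _ _ _

  -- The plane has no complement here, so the primitive vector of a `Deep` vertex would have no
  -- place for its unit entry.
  claim₀ : Graph.OrbitClaim 1 0 d z Rep10
  claim₀ α (prim , norm) α≁e₁ = [ (λ q → _ , Level.lift (λ _ → refl) , orbit q) ,
      (λ D → ⊥-elim (no-position D _ (Deep.unit D))) ]′
    (vertex-dichotomy anisotropic-perp prim norm α≁e₁)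
    where
    open RankOneClaims 0
    anisotropic-perp : ∀ {w} → Perp w → ¬ IsUnit (B w w) → ∀ i → ¬ IsUnit (w i)
    anisotropic-perp {w} w⊥ _ 0F = ≈0⇒nonunit (perp₀ w w⊥)
    anisotropic-perp {w} w⊥ _ 1F = ≈0⇒nonunit (perp₁ w w⊥)
    no-position : (D : Deep α) → ∀ i → ¬ IsUnit (Deep.v D i)
    no-position D 0F u = Deep.hidden-f₁ D (unit-cong (sym (B-f₁ (Deep.v D))) u)
    no-position D 1F u = Deep.hidden-e₁ D (unit-cong (sym (B-e₁ (Deep.v D))) u)

  -- The complement is the line through g, so every projection is already a multiple of g and no
  -- reflection is called for.
  claim₁ : Graph.OrbitClaim 1 1 d z Rep11
  claim₁ α (prim , norm) α≁e₁ = [ (λ q → _ , inj₁ (Level.lift (λ _ → refl)) , orbit q) , from-deep ]′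
    (vertex-dichotomy anisotropic-perp prim norm α≁e₁)
    where
    open RankOneClaims 1
    g : V
    g = basis 2F
    along-g : ∀ w → Perp w → w ≋ (w 2F ∙ g)
    along-g w w⊥ 0F = trans (perp₀ w w⊥) (sym (zeroʳ _))
    along-g w w⊥ 1F = trans (perp₁ w w⊥) (sym (zeroʳ _))
    along-g w w⊥ 2F = sym (*-identityʳ _)
    norm-g : ∀ w → B w g ≈ d * w 2F
    norm-g = B-diagonal 0F
    anisotropic-perp : ∀ {w} → Perp w → ¬ IsUnit (B w w) → ∀ i → ¬ IsUnit (w i)
    anisotropic-perp {w} w⊥ _ 0F = ≈0⇒nonunit (perp₀ w w⊥)
    anisotropic-perp {w} w⊥ _ 1F = ≈0⇒nonunit (perp₁ w w⊥)
    anisotropic-perp {w} w⊥ nu 2F u = nu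
        (unit-cong (sym (trans (B-cong {w} {w} {w} {w 2F ∙ g} (λ _ → refl) (along-g w w⊥))
      (trans (B-∙ʳ w (w 2F) g) (*-congˡ (norm-g w))))) (unit-* u (unit-* d-unit u)))
    v₂-unit : (D : Deep α) → ∀ i → IsUnit (Deep.v D i) → IsUnit (Deep.v D 2F)
    v₂-unit D 0F u = ⊥-elim (Deep.hidden-f₁ D (unit-cong (sym (B-f₁ (Deep.v D))) u))
    v₂-unit D 1F u = ⊥-elim (Deep.hidden-e₁ D (unit-cong (sym (B-e₁ (Deep.v D))) u))
    v₂-unit D 2F u = u
    from-deep : Deep α → ∃ λ β → Rep11 β × ∃ λ T → InStab T × (α ∼ (β ·M T))
    from-deep D = _ , inj₂ (r , 1≤r , r<s , shape) ,
      orbit (deep-reached D norm (v₂-unit D position unit) (basis⊥ 0F)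
        (≋⇒⇝ (≋-trans (along-g (proj v) (proj-perp v)) (λ i → *-congʳ (proj-diagonal v 0F)))))
      where
      open Deep D
      gg : B g g ≈ d
      gg = trans (norm-g g) (*-identityʳ d)
      shape : hyp 1# (- (h * (B g g * pw p (2 ℕ.* r)))) (pw p r ∙ g) ≋ v3 1# (- (h * (d * pw p (2 ℕ.* r))))
          (pw p r)
      shape 0F = solve 2 (λ t k → t :* :0 :+ :1 :* :1 :+ k :* :0 := :1) refl _ _
      shape 1F = trans (solve 2 (λ t k → t :* :0 :+ :1 :* :0 :+ k :* :1 := k) refl _ _)
          (-‿cong (*-congˡ (*-congʳ gg)))
      shape 2F = solve 2 (λ t k → t :* :1 :+ :1 :* :0 :+ k :* :0 := t) refl _ _

  claim₂ : Graph.OrbitClaim 1 2 d z Rep12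
  claim₂ α (prim , norm) α≁e₁ = [ (λ q → _ , inj₁ (Level.lift (λ _ → refl)) , orbit q) , from-deep ]′
    (vertex-dichotomy anisotropic-perp prim norm α≁e₁)
    where
    open RankOneClaims 2
    pair : Carrier → Carrier → V
    pair c f = (c ∙ basis 2F) ⊕ (f ∙ basis 3F)
    along-pair : ∀ w → Perp w → w ≋ pair (w 2F) (w 3F)
    along-pair w w⊥ 0F = trans (perp₀ w w⊥) (solve 2 (λ c f → :0 := c :* :0 :+ f :* :0) refl _ _)
    along-pair w w⊥ 1F = trans (perp₁ w w⊥) (solve 2 (λ c f → :0 := c :* :0 :+ f :* :0) refl _ _)
    along-pair w w⊥ 2F = solve 2 (λ c f → c := c :* :1 :+ f :* :0) refl _ _
    along-pair w w⊥ 3F = solve 2 (λ c f → f := c :* :0 :+ f :* :1) refl _ _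
    pair-perp : ∀ c f → Perp (pair c f)
    pair-perp c f = trans (B-e₁ (pair c f)) (solve 2 (λ c f → c :* :0 :+ f :* :0 := :0) refl c f) , trans
        (B-f₁ (pair c f)) (solve 2 (λ c f → c :* :0 :+ f :* :0 := :0) refl c f)
    B-pairʳ : ∀ w c f → B w (pair c f) ≈ c * (1# * w 2F) + f * (- z * w 3F)
    B-pairʳ w c f = trans (B-⊕ʳ w (c ∙ basis 2F) (f ∙ basis 3F))
      (+-cong (trans (B-∙ʳ w c (basis 2F)) (*-congˡ (B-diagonal 0F w)))
              (trans (B-∙ʳ w f (basis 3F)) (*-congˡ (B-diagonal 1F w))))
    B-pair : ∀ c f c′ f′ → B (pair c f) (pair c′ f′) ≈ c * c′ - z * (f * f′)
    B-pair c f c′ f′ = trans (B-pairʳ (pair c f) c′ f′)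
      (solve 5 (λ z c f c′ f′ → c′ :* (:1 :* (c :* :1 :+ f :* :0)) :+ f′ :* (:- z :* (c :* :0 :+ f :* :1))
          := c :* c′ :- z :* (f :* f′)) refl z c f c′ f′)
    anisotropic-perp : ∀ {w} → Perp w → ¬ IsUnit (B w w) → ∀ i → ¬ IsUnit (w i)
    anisotropic-perp {w} w⊥ nu = λ
      { 0F → ≈0⇒nonunit (perp₀ w w⊥) ; 1F → ≈0⇒nonunit (perp₁ w w⊥) ; 2F → proj₁ both ; 3F → proj₂ both }
      where
      both = anisotropic z-nonSquare
          (λ u → nu (unit-cong
          (sym (trans (B-cong {w} {pair (w 2F) (w 3F)} {w} {pair (w 2F) (w 3F)} (along-pair w w⊥)
          (along-pair w w⊥))
               (B-pair (w 2F) (w 3F) (w 2F) (w 3F)))) u))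
    -- The reflecting vector is the sum, because in the applications the two vectors agree modulo p
    -- and their difference would have nonunit norm. The price is a sign, which `deep-reached`
    -- absorbs as a unit factor.
    rotate : ∀ c f c′ f′ → c * c - z * (f * f) ≈ c′ * c′ - z * (f′ * f′) →
             IsUnit ((c + c′) * (c + c′) - z * ((f + f′) * (f + f′))) → pair c f ⇝ ((- 1#) ∙ pair c′ f′)
    rotate c f c′ f′ eq unit = ⇝-trans (⇝-difference (pair-perp _ _) (unit-cong (sym (B-pair _ _ _ _)) unit)
        (trans (+-cong (B-pair _ _ _ _) (B-pair _ _ _ _)) (trans (combine₁ _ eq
          (solve 5 (λ z c f c′ f′ → (c :* (c :+ c′) :- z :* (f :* (f :+ f′)))
              :+ (c :* (c :+ c′) :- z :* (f :* (f :+ f′)))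
            := (c :+ c′) :* (c :+ c′) :- z :* ((f :+ f′) :* (f :+ f′)) :+ :1 :* (c :* c :- z :* (f :* f)
                :- (c′ :* c′ :- z :* (f′ :* f′)))) refl z c f c′ f′))
          (sym (B-pair _ _ _ _)))))
      (≋⇒⇝ (λ i → solve 6 (λ c f c′ f′ x y → (c :* x :+ f :* y) :+ :- :1 :* ((c :+ c′) :* x :+ (f :+ f′) :* y)
          := :- :1 :* (c′ :* x :+ f′ :* y)) refl c f c′ f′ _ _))

    v4-cong : ∀ {y y′ a a′ b b′} → y ≈ y′ → a ≈ a′ → b ≈ b′ → v4 1# y a b ≋ v4 1# y′ a′ b′
    v4-cong p q t 0F = refl
    v4-cong p q t 1F = p
    v4-cong p q t 2F = q
    v4-cong p q t 3F = t

    from-deep : Deep α → ∃ λ β → Rep12 β × ∃ λ T → InStab T × (α ∼ (β ·M T))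
    from-deep D = classify (unit? γ) (unit? φ)
      where
      open Deep D
      ϖ = pw p r
      ϖ² = pw p (2 ℕ.* r)
      γ = v 2F
      φ = v 3F

      v-pair : proj v ≋ pair γ φ
      v-pair = ≋-trans (along-pair (proj v) (proj-perp v)) (λ i → +-cong (*-congʳ (proj-diagonal v 0F))
          (*-congʳ (proj-diagonal v 1F)))

      reach : ∀ {x} a b → IsUnit x → pair γ φ ⇝ (x ∙ pair a b) →
              α ↝ v4 1# (- (h * ((a * a - z * (b * b)) * ϖ²))) (a * ϖ) (b * ϖ)
      reach a b ux q = ↝-trans (deep-reached D norm ux (pair-perp a b) (⇝-trans (≋⇒⇝ v-pair) q)) (≋⇒↝ shape)
        where
        shape : hyp 1# (- (h * (B (pair a b) (pair a b) * ϖ²))) (ϖ ∙ pair a b)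
                ≋ v4 1# (- (h * ((a * a - z * (b * b)) * ϖ²))) (a * ϖ) (b * ϖ)
        shape 0F = solve 4 (λ t k a b → t :* (a :* :0 :+ b :* :0) :+ :1 :* :1 :+ k :* :0 := :1) refl _ _ a b
        shape 1F = trans (solve 4 (λ t k a b → t :* (a :* :0 :+ b :* :0) :+ :1 :* :0 :+ k :* :1
            := k) refl _ _ a b) (-‿cong (*-congˡ (*-congʳ (B-pair a b a b))))
        shape 2F = solve 4 (λ t k a b → t :* (a :* :1 :+ b :* :0) :+ :1 :* :0 :+ k :* :0
            := a :* t) refl _ _ a b
        shape 3F = solve 4 (λ t k a b → t :* (a :* :0 :+ b :* :1) :+ :1 :* :0 :+ k :* :0
            := b :* t) refl _ _ a b

      -- w² = 1 - z (φ/γ)², so (γ w , 0) has the same norm as (γ , φ). The sum of the two has norm 2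
      -- γ² w (1 + w), a unit.
      near-g₁ : ∀ {γ′} → γ * γ′ ≈ 1# → ¬ IsUnit φ → ∃ λ w → IsUnit w × (pair γ φ ⇝ ((- (γ * w)) ∙ pair 1# 0#))
      near-g₁ {γ′} γγ′ nφ = w , w-unit , ⇝-trans (rotate γ φ (γ * w) 0# equal-norm
          (unit-cong (combine₂ _ _ γγ′ ww
            (solve 5 (λ z γ γ′ φ w → (γ :* γ) :* ((w :+ w) :* (:1 :+ w))
              := (γ :+ γ :* w) :* (γ :+ γ :* w) :- z :* ((φ :+ :0) :* (φ :+ :0))
                :+ (:- (z :* φ :* φ) :* (γ :* γ′ :+ :1)) :* (γ :* γ′ :- :1)
                    :+ (γ :* γ) :* (w :* w :- (:1 :+ :- (z :* ((φ :* γ′) :* (φ :* γ′)))))) refl z γ γ′ φ w))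
            (unit-* (unit-* γ-unit γ-unit) (unit-* (unit-double w-unit) 1+w-unit))))
          (≋⇒⇝ (λ i → solve 4 (λ γ w x y → :- :1 :* (γ :* w :* x :+ :0 :* y)
              := :- (γ :* w) :* (:1 :* x :+ :0 :* y)) refl γ w _ _))
        where
        γ-unit : IsUnit γ
        γ-unit = γ′ , γγ′
        small = nonunit-neg (nonunit-*ʳ z (nonunit-*ˡ (φ * γ′) (nonunit-*ˡ γ′ nφ)))
        root = 1+nonunit-square small
        w = proj₁ root
        ww = proj₁ (proj₂ root)
        1+w-unit = proj₂ (proj₂ root)
        w-unit : IsUnit w
        w-unit = unit-*ˡ (unit-cong (sym ww) (unit+nonunit unit-1 small))
        equal-norm : γ * γ - z * (φ * φ) ≈ γ * w * (γ * w) - z * (0# * 0#)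
        equal-norm = combine₂ _ _ γγ′ ww (solve 5 (λ z γ γ′ φ w → γ :* γ :- z :* (φ :* φ)
            := γ :* w :* (γ :* w) :- z :* (:0 :* :0)
          :+ (z :* φ :* φ :* (γ :* γ′ :+ :1)) :* (γ :* γ′ :- :1)
              :+ (:- (γ :* γ)) :* (w :* w :- (:1 :+ :- (z :* ((φ :* γ′) :* (φ :* γ′)))))) refl z γ γ′ φ w)

      -- Now w² = 1 - z⁻¹ (γ/φ)², so (0 , φ w) has the same norm as (γ , φ); the sum of the two has
      -- norm -2 z φ² w (1 + w).
      near-g₂ : ∀ {φ′} → φ * φ′ ≈ 1# → ¬ IsUnit γ → ∃ λ w → IsUnit w × (pair γ φ ⇝ ((- (φ * w)) ∙ pair 0# 1#))
      near-g₂ {φ′} φφ′ nγ = w , w-unit , ⇝-trans (rotate γ φ 0# (φ * w) equal-norm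
          (unit-cong (combine₃ _ _ _ φφ′ zz′ ww
            (solve 6 (λ z z′ γ φ φ′ w → :- z :* (φ :* φ) :* ((w :+ w) :* (:1 :+ w))
              := (γ :+ :0) :* (γ :+ :0) :- z :* ((φ :+ φ :* w) :* (φ :+ φ :* w))
                :+ (z :* z′ :* γ :* γ :* (φ :* φ′ :+ :1)) :* (φ :* φ′ :- :1) :+ (γ :* γ) :* (z :* z′ :- :1)
                :+ (:- (z :* (φ :* φ))) :* (w :* w :- (:1 :+ :- (z′ :* ((γ :* φ′) :* (γ :* φ′)))))) refl z z′
                    γ φ φ′ w))
            (unit-* (unit-* (unit-neg z-unit) (unit-* φ-unit φ-unit)) (unit-* (unit-double w-unit)
                1+w-unit))))
          (≋⇒⇝ (λ i → solve 4 (λ φ w x y → :- :1 :* (:0 :* x :+ φ :* w :* y)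
              := :- (φ :* w) :* (:0 :* x :+ :1 :* y)) refl φ w _ _))
        where
        z-unit = proj₁ z-nonSquare
        z′ = proj₁ z-unit
        zz′ = proj₂ z-unit
        φ-unit : IsUnit φ
        φ-unit = φ′ , φφ′
        small = nonunit-neg (nonunit-*ʳ z′ (nonunit-*ˡ (γ * φ′) (nonunit-*ˡ φ′ nγ)))
        root = 1+nonunit-square small
        w = proj₁ root
        ww = proj₁ (proj₂ root)
        1+w-unit = proj₂ (proj₂ root)
        w-unit : IsUnit w
        w-unit = unit-*ˡ (unit-cong (sym ww) (unit+nonunit unit-1 small))
        equal-norm : γ * γ - z * (φ * φ) ≈ 0# * 0# - z * (φ * w * (φ * w))
        equal-norm = combine₃ _ _ _ φφ′ zz′ ww (solve 6 (λ z z′ γ φ φ′ w → γ :* γ :- z :* (φ :* φ)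
            := :0 :* :0 :- z :* (φ :* w :* (φ :* w))
          :+ (:- (z :* z′ :* γ :* γ :* (φ :* φ′ :+ :1))) :* (φ :* φ′ :- :1)
              :+ (:- (γ :* γ)) :* (z :* z′ :- :1)
          :+ (z :* (φ :* φ)) :* (w :* w :- (:1 :+ :- (z′ :* ((γ :* φ′) :* (γ :* φ′)))))) refl z z′ γ φ φ′ w)

      no-position : ¬ IsUnit γ → ¬ IsUnit φ → ∀ i → ¬ IsUnit (v i)
      no-position nγ nφ 0F u = hidden-f₁ (unit-cong (sym (B-f₁ v)) u)
      no-position nγ nφ 1F u = hidden-e₁ (unit-cong (sym (B-e₁ v)) u)
      no-position nγ nφ 2F u = nγ u
      no-position nγ nφ 3F u = nφ u

      classify : Dec (IsUnit γ) → Dec (IsUnit φ) → ∃ λ β → Rep12 β × ∃ λ T → InStab T × (α ∼ (β ·M T))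
      -- Pulling out φ leaves (γ/φ , 1), already of the listed shape with b = γ/φ.
      classify (yes uγ) (yes (φ′ , φφ′)) =
        _ , inj₂ (inj₂ (inj₂ (r , 1≤r , r<s , γ * φ′ , unit-* uγ (φ , trans (*-comm φ′ φ) φφ′) ,
          v4-cong (solve 4 (λ h z b t → :- (h :* ((b :* b :- z :* (:1 :* :1)) :* t))
              := :- (h :* ((b :* b :- z) :* t))) refl h z (γ * φ′) ϖ²) refl (*-identityˡ ϖ)))) ,
        orbit (reach (γ * φ′) 1# (φ′ , φφ′) (≋⇒⇝ (λ i → combine₁ _ φφ′
          (solve 5 (λ c f f′ x y → c :* x :+ f :* y
              := f :* ((c :* f′) :* x :+ :1 :* y) :+ (:- (c :* x)) :* (f :* f′ :- :1)) refl γ φ φ′ _ _))))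
      classify (yes (γ′ , γγ′)) (no nφ) = let w , w-unit , q = near-g₁ γγ′ nφ in
        _ , inj₂ (inj₁ (r , 1≤r , r<s ,
          v4-cong (solve 3 (λ h z t → :- (h :* ((:1 :* :1 :- z :* (:0 :* :0)) :* t))
              := :- (h :* t)) refl h z ϖ²) (*-identityˡ ϖ) (zeroˡ ϖ))) ,
        orbit (reach 1# 0# (unit-neg (unit-* (γ′ , γγ′) w-unit)) q)
      classify (no nγ) (yes (φ′ , φφ′)) = let w , w-unit , q = near-g₂ φφ′ nγ in
        _ , inj₂ (inj₂ (inj₁ (r , 1≤r , r<s ,
          v4-cong (solve 3 (λ h z t → :- (h :* ((:0 :* :0 :- z :* (:1 :* :1)) :* t))
              := h :* (z :* t)) refl h z ϖ²) (zeroˡ ϖ) (*-identityˡ ϖ)))) ,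
        orbit (reach 0# 1# (unit-neg (unit-* (φ′ , φφ′) w-unit)) q)
      classify (no nγ) (no nφ) = ⊥-elim (no-position nγ nφ position unit)

theorem2p5 : {c ℓ : Level} (R : CommutativeRing c ℓ) →
    let open CommutativeRing R in
    let open Orth R in
    (p s m : ℕ) → Prime p → p % 2 ≡ 1 → 2 ≤ s → 1 ≤ m → IsGaloisRing p s m →
    (z : Carrier) → IsNonSquareUnit z →
    (d : Carrier) → (d ≈ 1# ⊎ d ≈ z) →
    (h : Carrier) → h + h ≈ 1# →
    let open Reps p s h z d in
    (Graph.OrbitClaim 1 0 d z Rep10
    × Graph.OrbitClaim 1 1 d z Rep11
    × Graph.OrbitClaim 1 2 d z Rep12)
    × ((ν δ : ℕ) → 2 ≤ ν → δ ≤ 2 → Graph.OrbitClaim ν δ d z (Rep2 ν δ))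
theorem2p5 R p s m p-prime _ _ _ galois z z-nonSquare d d-choice h h+h≈1 =
    (claim₀ , claim₁ , claim₂) , HigherRankClaim.claim
  where
  open CommutativeRing R using (_*_; 1#; sym; *-congʳ; trans; *-identityˡ)
  open Orth R using (IsUnit)
  d-unit : IsUnit d
  d-unit = [ (λ d≈1 → 1# , trans (*-congʳ d≈1) (*-identityˡ 1#)) ,
             (λ d≈z → proj₁ (proj₁ z-nonSquare) , trans (*-congʳ d≈z) (proj₂ (proj₁ z-nonSquare))) ]′ d-choice
  open OrbitClaims R p s m p-prime galois z z-nonSquare d d-unit h h+h≈1
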